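{- For all integers $n\geq 0$, $$a_{1^{1}2^{ -3}3^{ -3}4^{2}}(2n)>0,\quad a_{1^{1}2^{ -3}3^{ -3}4^{2}}(6n+1)<0,\quad a_{1^{1}2^{ -3}3^{ -3}4^{2}}(6n+3)=0,\quad a_{1^{1}2^{ -3}3^{ -3}4^{2}}(6n+5)=0.$$
   Context: For $|q|<1$ (or as formal power series in $q$) let $f_j:=(q^j;q^j)_\infty=\prod_{k\ge 1}(1-q^{jk})$ for each positive integer $j$. The integers $a_{1^{1}2^{ -3}3^{ -3}4^{2}}(n)$, $n\ge 0$, are defined by $\sum_{n=0}^\infty a_{1^{1}2^{ -3}3^{ -3}4^{2}}(n)q^n=\dfrac{f_1f_4^2}{f_2^3f_3^3}$. -}

module Defs where

open import Algebra.Bundles.Raw using (RawSemiring)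
open import Data.Bool.Base using (if_then_else_)
open import Data.Fin.Base using (toℕ)
open import Data.Integer.Base as ℤ using (ℤ; 0ℤ; 1ℤ)
import Data.Integer.Properties as ℤ
open import Data.Nat.Base as ℕ using (ℕ; zero; suc; NonZero; _≡ᵇ_; _∸_; z≤n; s≤s)
import Data.Nat.Properties as ℕ
open import Level using (0ℓ)
open import Relation.Binary.PropositionalEquality

open import Algebra.Properties.Monoid.Sum ℤ.+-0-monoid using (sum)

-- The formal power series Σ (A n) qⁿ is represented by A; equality of
-- series is pointwise equality _≗_.
Series : Set
Series = ℕ → ℤ

infix  9 q^_
infixl 7 _*_ _/_
infixl 6 _+_ _-_

q^_ : ℕ → Series
(q^ m) n = if n ≡ᵇ m then 1ℤ else 0ℤ

0# 1# : Series
0# _ = 0ℤ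
1# = q^ 0

_+_ _-_ _*_ : Series → Series → Series
(A + B) n = A n ℤ.+ B n
(A - B) n = A n ℤ.- B n
(A * B) n = sum {suc n} (λ i → A (toℕ i) ℤ.* B (n ∸ toℕ i))

series : RawSemiring 0ℓ 0ℓ
series = record { Carrier = Series ; _≈_ = _≗_ ; _+_ = _+_ ; _*_ = _*_ ; 0# = 0# ; 1# = 1# }

open import Algebra.Definitions.RawSemiring series public using (_^_)

-- Long division.  It is the quotient whenever the divisor has constant
-- term 1, see /-correct; on other divisors it has no meaning.
_/_ : Series → Series → Series
(A / B) zero    = A 0
(A / B) (suc n) = ((λ k → A (suc k) ℤ.- A 0 ℤ.* B (suc k)) / B) n

/-correct : ∀ A B → B 0 ≡ 1ℤ → (A / B) * B ≗ A
/-correct A B B₀≡1 zero = begin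
  A 0 ℤ.* B 0 ℤ.+ 0ℤ  ≡⟨ ℤ.+-identityʳ _ ⟩
  A 0 ℤ.* B 0         ≡⟨ cong (A 0 ℤ.*_) B₀≡1 ⟩
  A 0 ℤ.* 1ℤ          ≡⟨ ℤ.*-identityʳ _ ⟩
  A 0                 ∎
  where open ≡-Reasoning
/-correct A B B₀≡1 (suc n) = begin
  x ℤ.+ ((A′ / B) * B) n         ≡⟨ cong (λ y → x ℤ.+ y) (/-correct A′ B B₀≡1 n) ⟩
  x ℤ.+ (A (suc n) ℤ.- x)        ≡⟨ ℤ.+-comm x _ ⟩
  A (suc n) ℤ.- x ℤ.+ x          ≡⟨ ℤ.+-assoc (A (suc n)) (ℤ.- x) x ⟩
  A (suc n) ℤ.+ (ℤ.- x ℤ.+ x)    ≡⟨ cong (λ y → A (suc n) ℤ.+ y) (ℤ.+-inverseˡ x) ⟩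
  A (suc n) ℤ.+ 0ℤ               ≡⟨ ℤ.+-identityʳ _ ⟩
  A (suc n)                      ∎
  where
  open ≡-Reasoning
  x : ℤ
  x = A 0 ℤ.* B (suc n)
  A′ : Series
  A′ k = A (suc k) ℤ.- A 0 ℤ.* B (suc k)

-- ∏ (1 - q^(j k)) over 1 ≤ k ≤ N
f-upto : ℕ → ℕ → Series
f-upto j zero    = 1#
f-upto j (suc N) = f-upto j N * (1# - q^ (j ℕ.* suc N))

-- f j = (q^j ; q^j)_∞.  For j ≥ 1 the coefficient of qⁿ in the partial
-- products is constant from N = n on (f-stable), and the infinite product
-- has this eventual value as its coefficient.
f : (j : ℕ) .{{_ : NonZero j}} → Series
f j n = f-upto j n n

private
  q^-below : ∀ {m n} → n ℕ.< m → (q^ m) n ≡ 0ℤ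
  q^-below {suc m} {zero}  _         = refl
  q^-below {suc m} {suc n} (s≤s n<m) = q^-below n<m

  *-identityʳ-upto : ∀ A B n → (∀ k → k ℕ.≤ n → B k ≡ 1# k) → (A * B) n ≡ A n
  *-identityʳ-upto A B zero    B≡1 =
    trans (ℤ.+-identityʳ _) (trans (cong (A 0 ℤ.*_) (B≡1 0 z≤n)) (ℤ.*-identityʳ _))
  *-identityʳ-upto A B (suc n) B≡1 = begin
    A 0 ℤ.* B (suc n) ℤ.+ (A′ * B) n  ≡⟨ cong₂ (λ x y → A 0 ℤ.* x ℤ.+ y) (B≡1 (suc n) ℕ.≤-refl)
                                               (*-identityʳ-upto A′ B n λ k k≤n → B≡1 k (ℕ.m≤n⇒m≤1+n k≤n)) ⟩
    A 0 ℤ.* 0ℤ ℤ.+ A (suc n)          ≡⟨ cong (λ y → y ℤ.+ A (suc n)) (ℤ.*-zeroʳ (A 0)) ⟩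
    0ℤ ℤ.+ A (suc n)                  ≡⟨ ℤ.+-identityˡ _ ⟩
    A (suc n)                         ∎
    where
    open ≡-Reasoning
    A′ : Series
    A′ k = A (suc k)

f-stable : ∀ j .{{_ : NonZero j}} {n N} → n ℕ.≤ N → f-upto j N n ≡ f j n
f-stable j n≤N = go (ℕ.≤⇒≤′ n≤N)
  where
  go : ∀ {n N} → n ℕ.≤′ N → f-upto j N n ≡ f j n
  go ℕ.≤′-refl = refl
  go {n} {suc N} (ℕ.≤′-step n≤′N) = trans
    (*-identityʳ-upto (f-upto j N) (1# - q^ (j ℕ.* suc N)) n λ k k≤n →
      trans (cong (λ y → 1# k ℤ.- y) (q^-below (k<m k≤n))) (ℤ.+-identityʳ _))
    (go n≤′N)
    where
    k<m : ∀ {k} → k ℕ.≤ n → k ℕ.< j ℕ.* suc N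
    k<m k≤n = ℕ.≤-trans (s≤s (ℕ.≤-trans k≤n (ℕ.≤′⇒≤ n≤′N))) (ℕ.m≤n*m (suc N) j)

a1¹2⁻³3⁻³4² : Series
a1¹2⁻³3⁻³4² = (f 1 * f 4 ^ 2) / (f 2 ^ 3 * f 3 ^ 3)

a-correct : a1¹2⁻³3⁻³4² * (f 2 ^ 3 * f 3 ^ 3) ≗ f 1 * f 4 ^ 2
a-correct = /-correct (f 1 * f 4 ^ 2) (f 2 ^ 3 * f 3 ^ 3) refl

{-# OPTIONS --safe #-}

-- Write a(q) for the series, ψ(q) = f₂²/f₁ = Σ q^(n(n+1)/2) with n ≥ 0,
-- φ(q) = Σ q^(n²) and f(x,y) = Σ x^(n(n+1)/2) y^(n(n-1)/2) with n in ℤ.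
-- Splitting the double series f(-q,-q⁵) φ(q³) by the parity of the sum of the
-- two indices gives
--     f(-q,-q⁵) φ(q³) = f(-q⁴,-q⁸)² - q f(-q¹⁰,-q²)².
-- By the Jacobi triple product every factor is a quotient of products f_j, and
-- the identity becomes
--     a(q) = ψ(q²)² f₁₂²/f₆⁷ - q f₁₂⁶/f₆⁹.
-- The first summand is a series in q², the second one is -q times a series in
-- q⁶.  The coefficients of these two series are positive since ψ(q²),
-- f₁₂/f₆ = ∏ (1 + q^(6k)) and 1/f₆ = ∏ 1/(1 - q^(6k)) have nonnegative ones.
module Submission where

open import Data.Integer using (0ℤ; _<_; _>_)
open import Data.Nat using (ℕ; _+_; _*_)
open import Data.Product using (_×_)
open import Relation.Binary.PropositionalEquality using (_≡_)
open import Defs using (a1¹2⁻³3⁻³4²)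

open import Algebra.Bundles using (CommutativeSemiring)
import Algebra.Solver.CommutativeMonoid as CommutativeMonoidSolver
import Algebra.Solver.Ring.NaturalCoefficients.Default as SemiringSolver
open import Algebra.Structures.Biased using (isCommutativeSemiringˡ)
open import Data.Empty using (⊥; ⊥-elim)
open import Data.Integer.Base as ℤ using (ℤ; 1ℤ; -1ℤ; _⊖_; +_; -[1+_]; ∣_∣; +<+; +≤+)
open import Data.Integer.DivMod using (_/ℕ_; _%ℕ_; a≡a%ℕn+[a/ℕn]*n; n%ℕd<d)
import Data.Integer.Properties as ℤ
open import Algebra.Properties.AbelianGroup ℤ.+-0-abelianGroup using () renaming (∙-cancelˡ to ℤ-+-cancelˡ; ∙-cancelʳ to ℤ-+-cancelʳ)
open import Data.Integer.Tactic.RingSolver using (solve-∀)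
open import Data.List.Base using (List; []; _∷_; map; _++_; cartesianProduct; applyUpTo)
open import Data.List.Membership.Propositional using (_∈_)
open import Data.List.Membership.Propositional.Properties using (∈-∃++; ∈-applyUpTo⁺; ∈-applyUpTo⁻; ∈-cartesianProduct⁺; ∈-cartesianProduct⁻; ∈-map⁺; ∈-map⁻; ∈-++⁺ˡ; ∈-++⁺ʳ)
open import Data.List.Relation.Binary.Permutation.Propositional as ↭ using (_↭_; ↭-sym; ↭⇒↭ₛ)
open import Data.List.Relation.Binary.Permutation.Propositional.Properties using (∈-resp-↭) renaming (shift to ↭-shift)
import Data.List.Relation.Binary.Permutation.Setoid.Properties as ↭ₛ
import Data.List.Relation.Unary.All as All
open import Data.List.Relation.Unary.AllPairs using ([]; _∷_)
open import Data.List.Relation.Unary.Any using (here; there)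
open import Data.List.Relation.Unary.Unique.Propositional using (Unique)
import Data.List.Relation.Unary.Unique.Propositional.Properties as Unique
open import Data.Nat.Base as ℕ using (zero; suc; _∸_; _≤_; z≤n; s≤s; NonZero; >-nonZero; _≤′_; ≤′-refl; ≤′-step)
open import Data.Nat.Divisibility using (_∣_; _∤_; _∣?_; _∣0; ∣-trans; m∣m*n; ∣m∣n⇒∣m+n; ∣m+n∣m⇒∣n; m%n≡0⇒n∣m; n∣m⇒m%n≡0; ∣-refl; ∣m⇒∣m*n)
open import Data.Nat.DivMod using (_%_; _/_; m≡m%n+[m/n]*n; m%n<n; m<n⇒m%n≡m; [m+n]%n≡m%n)
import Data.Nat.Properties as ℕ
open import Data.Nat.Tactic.RingSolver using () renaming (solve-∀ to ℕ-solve-∀)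
open import Data.Product using (_,_; proj₁; proj₂; ∃)
open import Data.Sum using (_⊎_; inj₁; inj₂)
open import Function.Base using (_∘_)
open import Level using (0ℓ)
import Relation.Binary.Reasoning.Setoid as SetoidReasoning
open import Relation.Binary.PropositionalEquality using (_≢_; _≗_; refl; sym; trans; cong; cong₂; subst; module ≡-Reasoning)
open import Relation.Binary.PropositionalEquality.Properties using (setoid)
open import Relation.Binary.Structures using (IsEquivalence)
open import Relation.Nullary using (yes; no)
open import Relation.Nullary.Decidable using (from-no; from-yes)
open import Defs using (Series; q^_; 0#; 1#; f; f-upto; a-correct) renaming (_+_ to _+ˢ_; _*_ to _*ˢ_)

-- No limits are taken. Each identity is proved modulo q^(K+1) for arbitrary K, where a product
-- needs finitely many factors and a theta series finitely many indices; the coefficient of q^n is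
-- read at K = n. Series have the single variable q, so Jacobi's identity is proved directly at x =
-- ε q^i, y = ε q^j with ε² = 1. It comes from a finite q-binomial identity whose Gaussian
-- coefficients approach 1/f_(i+j). The parity splitting works because the exponent 3m² - 2m + 3n²
-- has equal quadratic coefficients, so that rotated indices s, t have no cross term. The obstacle
-- is truncation: a square range of (m, n) is not a square range of (s, t). A larger square in (s,
-- t) is used, and the extra pairs contribute nothing modulo q^(K+1). To reach a(q), the dissection
-- is multiplied by f₂f₃³f₄²f₁₂²/f₆⁷, which turns f(-q,-q⁵) φ(q³) into the numerator f₁f₄². Strict
-- positivity needs more than nonnegative factors: 1/f₆ reaches only the multiples of 6, and ψ(q²)²
-- = 1 + 2q² + q⁴ + ... supplies the exponents 0, 2 and 4.

-- The semiring of series modulo q^(K+1)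

private variable
  A A′ B B′ C : Series

infix 4 _≈[_]_

-- Congruence modulo q^(K+1)
record _≈[_]_ (A : Series) (K : ℕ) (B : Series) : Set where
  constructor mod
  field coeff : ∀ {n} → n ≤ K → A n ≡ B n

open _≈[_]_

≗⇒≈ : ∀ {K} → A ≗ B → A ≈[ K ] B
≗⇒≈ A≗B = mod λ {n} _ → A≗B n

≈-weaken : ∀ {K L} → K ≤ L → A ≈[ L ] B → A ≈[ K ] B
≈-weaken K≤L A≈B = mod λ n≤K → coeff A≈B (ℕ.≤-trans n≤K K≤L)

tail : Series → Series
tail A = A ∘ suc

infixr 8 _∙_

_∙_ : ℤ → Series → Series
(c ∙ A) n = c ℤ.* A n

infixl 6 _⊕_
infixl 7 _⊛_

-- Opaque copies of the series operations, so that unification does not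
-- compare series coefficient by coefficient.
opaque
  _⊕_ _⊛_ : Series → Series → Series
  _⊕_ = _+ˢ_
  _⊛_ = _*ˢ_

opaque
  unfolding _⊕_ _⊛_

  ⊕-coeff : ∀ A B n → (A ⊕ B) n ≡ A n ℤ.+ B n
  ⊕-coeff A B n = refl

  ⊕-cong : ∀ {K} → A ≈[ K ] A′ → B ≈[ K ] B′ → A ⊕ B ≈[ K ] A′ ⊕ B′
  ⊕-cong A≈ B≈ = mod λ n≤K → cong₂ ℤ._+_ (coeff A≈ n≤K) (coeff B≈ n≤K)

  ⊕-assoc : ∀ A B C → (A ⊕ B) ⊕ C ≗ A ⊕ (B ⊕ C)
  ⊕-assoc A B C n = ℤ.+-assoc (A n) (B n) (C n)

  ⊕-identityˡ : ∀ A → 0# ⊕ A ≗ A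
  ⊕-identityˡ A n = ℤ.+-identityˡ (A n)

  ⊕-comm : ∀ A B → A ⊕ B ≗ B ⊕ A
  ⊕-comm A B n = ℤ.+-comm (A n) (B n)

  ⊛-cong : ∀ {K} → A ≈[ K ] A′ → B ≈[ K ] B′ → A ⊛ B ≈[ K ] A′ ⊛ B′
  ⊛-cong A≈ B≈ = mod (go A≈ B≈)
    where
    go : ∀ {K n} → A ≈[ K ] A′ → B ≈[ K ] B′ → n ≤ K → (A ⊛ B) n ≡ (A′ ⊛ B′) n
    go A≈ B≈ z≤n = cong (ℤ._+ 0ℤ) (cong₂ ℤ._*_ (coeff A≈ z≤n) (coeff B≈ z≤n))
    go A≈ B≈ (s≤s n≤K) = cong₂ ℤ._+_
      (cong₂ ℤ._*_ (coeff A≈ z≤n) (coeff B≈ (s≤s n≤K)))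
      (go (mod λ i≤K → coeff A≈ (s≤s i≤K)) (≈-weaken (ℕ.n≤1+n _) B≈) n≤K)

  ⊛-zeroˡ : ∀ A → 0# ⊛ A ≗ 0#
  ⊛-zeroˡ A zero    = refl
  ⊛-zeroˡ A (suc n) = trans (ℤ.+-identityˡ _) (⊛-zeroˡ A n)

  ⊛-identityˡ : ∀ A → 1# ⊛ A ≗ A
  ⊛-identityˡ A zero    = trans (ℤ.+-identityʳ _) (ℤ.*-identityˡ _)
  ⊛-identityˡ A (suc n) = begin
    1ℤ ℤ.* A (suc n) ℤ.+ (0# ⊛ A) n ≡⟨ cong₂ ℤ._+_ (ℤ.*-identityˡ (A (suc n))) (⊛-zeroˡ A n) ⟩
    A (suc n) ℤ.+ 0ℤ                ≡⟨ ℤ.+-identityʳ _ ⟩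
    A (suc n)                       ∎
    where open ≡-Reasoning

  -- The product recurses by taking the tail of its left factor. This is the mirror recursion on the
  -- right factor, which commutativity requires.
  ⊛-suc : ∀ A B n → (A ⊛ B) (suc n) ≡ (A ⊛ tail B) n ℤ.+ A (suc n) ℤ.* B 0
  ⊛-suc A B zero    = lemma (A 0 ℤ.* B 1) (A 1 ℤ.* B 0)
    where
    lemma : ∀ x y → x ℤ.+ (y ℤ.+ 0ℤ) ≡ x ℤ.+ 0ℤ ℤ.+ y
    lemma = solve-∀
  ⊛-suc A B (suc n) = trans
    (cong (λ y → A 0 ℤ.* B (suc (suc n)) ℤ.+ y) (⊛-suc (tail A) B n))
    (sym (ℤ.+-assoc (A 0 ℤ.* B (suc (suc n))) _ _))

  ⊛-comm : ∀ A B → A ⊛ B ≗ B ⊛ A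
  ⊛-comm A B zero    = cong (ℤ._+ 0ℤ) (ℤ.*-comm (A 0) (B 0))
  ⊛-comm A B (suc n) = begin
    A 0 ℤ.* B (suc n) ℤ.+ (tail A ⊛ B) n ≡⟨ cong₂ ℤ._+_ (ℤ.*-comm (A 0) _) (⊛-comm (tail A) B n) ⟩
    B (suc n) ℤ.* A 0 ℤ.+ (B ⊛ tail A) n ≡⟨ ℤ.+-comm (B (suc n) ℤ.* A 0) _ ⟩
    (B ⊛ tail A) n ℤ.+ B (suc n) ℤ.* A 0 ≡⟨ ⊛-suc B A n ⟨
    (B ⊛ A) (suc n)                      ∎
    where open ≡-Reasoning

  ⊛-distribʳ : ∀ C A B → (A ⊕ B) ⊛ C ≗ (A ⊛ C) ⊕ (B ⊛ C)
  ⊛-distribʳ C A B zero    = lemma (A 0) (B 0) (C 0)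
    where
    lemma : ∀ a b c → (a ℤ.+ b) ℤ.* c ℤ.+ 0ℤ ≡ (a ℤ.* c ℤ.+ 0ℤ) ℤ.+ (b ℤ.* c ℤ.+ 0ℤ)
    lemma = solve-∀
  ⊛-distribʳ C A B (suc n) = trans
    (cong (λ y → (A 0 ℤ.+ B 0) ℤ.* C (suc n) ℤ.+ y) (⊛-distribʳ C (tail A) (tail B) n))
    (lemma (A 0) (B 0) (C (suc n)) _ _)
    where
    lemma : ∀ a b c x y → (a ℤ.+ b) ℤ.* c ℤ.+ (x ℤ.+ y) ≡ (a ℤ.* c ℤ.+ x) ℤ.+ (b ℤ.* c ℤ.+ y)
    lemma = solve-∀

  ∙-⊛-assoc : ∀ c A B → (c ∙ A) ⊛ B ≗ c ∙ (A ⊛ B)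
  ∙-⊛-assoc c A B zero    = lemma c (A 0) (B 0)
    where
    lemma : ∀ c a b → c ℤ.* a ℤ.* b ℤ.+ 0ℤ ≡ c ℤ.* (a ℤ.* b ℤ.+ 0ℤ)
    lemma = solve-∀
  ∙-⊛-assoc c A B (suc n) = trans
    (cong (λ y → c ℤ.* A 0 ℤ.* B (suc n) ℤ.+ y) (∙-⊛-assoc c (tail A) B n))
    (lemma c (A 0) (B (suc n)) _)
    where
    lemma : ∀ c a b x → c ℤ.* a ℤ.* b ℤ.+ c ℤ.* x ≡ c ℤ.* (a ℤ.* b ℤ.+ x)
    lemma = solve-∀

  ⊛-assoc : ∀ A B C → (A ⊛ B) ⊛ C ≗ A ⊛ (B ⊛ C)
  ⊛-assoc A B C zero    = lemma (A 0) (B 0) (C 0)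
    where
    lemma : ∀ a b c → (a ℤ.* b ℤ.+ 0ℤ) ℤ.* c ℤ.+ 0ℤ ≡ a ℤ.* (b ℤ.* c ℤ.+ 0ℤ) ℤ.+ 0ℤ
    lemma = solve-∀
  ⊛-assoc A B C (suc n) = begin
    -- The tail of `A ⊛ B` is `(A 0 ∙ tail B) ⊕ (tail A ⊛ B)` by computation.
    (A 0 ℤ.* B 0 ℤ.+ 0ℤ) ℤ.* C (suc n) ℤ.+ (((A 0 ∙ tail B) ⊕ (tail A ⊛ B)) ⊛ C) n
      ≡⟨ cong (λ y → (A 0 ℤ.* B 0 ℤ.+ 0ℤ) ℤ.* C (suc n) ℤ.+ y) (⊛-distribʳ C (A 0 ∙ tail B) (tail A ⊛ B) n) ⟩
    (A 0 ℤ.* B 0 ℤ.+ 0ℤ) ℤ.* C (suc n) ℤ.+ (((A 0 ∙ tail B) ⊛ C) n ℤ.+ ((tail A ⊛ B) ⊛ C) n)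
      ≡⟨ cong₂ (λ x y → (A 0 ℤ.* B 0 ℤ.+ 0ℤ) ℤ.* C (suc n) ℤ.+ (x ℤ.+ y))
           (∙-⊛-assoc (A 0) (tail B) C n) (⊛-assoc (tail A) B C n) ⟩
    (A 0 ℤ.* B 0 ℤ.+ 0ℤ) ℤ.* C (suc n) ℤ.+ (A 0 ℤ.* (tail B ⊛ C) n ℤ.+ (tail A ⊛ (B ⊛ C)) n)
      ≡⟨ lemma (A 0) (B 0) (C (suc n)) _ _ ⟩
    (A ⊛ (B ⊛ C)) (suc n) ∎
    where
    open ≡-Reasoning
    lemma : ∀ a b c x y → (a ℤ.* b ℤ.+ 0ℤ) ℤ.* c ℤ.+ (a ℤ.* x ℤ.+ y) ≡ a ℤ.* (b ℤ.* c ℤ.+ x) ℤ.+ y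
    lemma = solve-∀

≈-isEquivalence : ∀ K → IsEquivalence _≈[ K ]_
≈-isEquivalence K = record
  { refl  = mod λ _ → refl
  ; sym   = λ A≈B → mod λ n≤K → sym (coeff A≈B n≤K)
  ; trans = λ A≈B B≈C → mod λ n≤K → trans (coeff A≈B n≤K) (coeff B≈C n≤K) }

seriesMod : ℕ → CommutativeSemiring 0ℓ 0ℓ
seriesMod K = record
  { Carrier = Series ; _≈_ = _≈[ K ]_ ; _+_ = _⊕_ ; _*_ = _⊛_ ; 0# = 0# ; 1# = 1#
  ; isCommutativeSemiring = isCommutativeSemiringˡ record
    { +-isCommutativeMonoid = record
      { isMonoid = record
        { isSemigroup = record
          { isMagma = record
            { isEquivalence = ≈-isEquivalence K
            ; ∙-cong = ⊕-cong }
          ; assoc = λ A B C → ≗⇒≈ (⊕-assoc A B C) }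
        ; identity = (λ A → ≗⇒≈ (⊕-identityˡ A))
                   , (λ A → ≗⇒≈ λ n → trans (⊕-comm A 0# n) (⊕-identityˡ A n)) }
      ; comm = λ A B → ≗⇒≈ (⊕-comm A B) }
    ; *-isCommutativeMonoid = record
      { isMonoid = record
        { isSemigroup = record
          { isMagma = record
            { isEquivalence = ≈-isEquivalence K
            ; ∙-cong = ⊛-cong }
          ; assoc = λ A B C → ≗⇒≈ (⊛-assoc A B C) }
        ; identity = (λ A → ≗⇒≈ (⊛-identityˡ A))
                   , (λ A → ≗⇒≈ λ n → trans (⊛-comm A 1# n) (⊛-identityˡ A n)) }
      ; comm = λ A B → ≗⇒≈ (⊛-comm A B) }
    ; distribʳ = λ A B C → ≗⇒≈ (⊛-distribʳ A B C)
    ; zeroˡ = λ A → ≗⇒≈ (⊛-zeroˡ A)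
    }
  }

-- Monomials

shift : ℕ → Series → Series
shift zero    A         = A
shift (suc e) A zero    = 0ℤ
shift (suc e) A (suc n) = shift e A n

opaque
  mono : ℤ → ℕ → Series
  mono c e = c ∙ q^ e

opaque
  unfolding mono _⊕_ _⊛_

  mono-1-0 : ∀ {K} → mono 1ℤ 0 ≈[ K ] 1#
  mono-1-0 = ≗⇒≈ λ n → ℤ.*-identityˡ (1# n)

  mono-⊕-mono : ∀ {K} c d e → mono c e ⊕ mono d e ≈[ K ] mono (c ℤ.+ d) e
  mono-⊕-mono c d e = ≗⇒≈ λ n → sym (ℤ.*-distribʳ-+ ((q^ e) n) c d)

  mono-0 : ∀ {K} e → mono 0ℤ e ≈[ K ] 0#
  mono-0 e = ≗⇒≈ λ n → ℤ.*-zeroˡ ((q^ e) n)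

  mono-⊛ : ∀ c e A → mono c e ⊛ A ≗ c ∙ shift e A
  mono-⊛ c zero    A n       = trans (∙-⊛-assoc c 1# A n) (cong (c ℤ.*_) (⊛-identityˡ A n))
  mono-⊛ c (suc e) A zero    = trans (ℤ.+-identityʳ _) (trans (cong (ℤ._* A 0) (ℤ.*-zeroʳ c)) (sym (ℤ.*-zeroʳ c)))
  mono-⊛ c (suc e) A (suc n) = trans
    (cong₂ ℤ._+_ (cong (ℤ._* A (suc n)) (ℤ.*-zeroʳ c)) (mono-⊛ c e A n)) (ℤ.+-identityˡ _)

  shift-mono : ∀ e d g → shift e (mono d g) ≗ mono d (e + g)
  shift-mono zero    d g n       = refl
  shift-mono (suc e) d g zero    = sym (ℤ.*-zeroʳ d)
  shift-mono (suc e) d g (suc n) = shift-mono e d g n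

  mono-*-mono : ∀ {K} c e d g → mono c e ⊛ mono d g ≈[ K ] mono (c ℤ.* d) (e + g)
  mono-*-mono c e d g = ≗⇒≈ λ n → trans (mono-⊛ c e (mono d g) n)
    (trans (cong (c ℤ.*_) (shift-mono e d g n)) (sym (ℤ.*-assoc c d _)))

  shift-cong : ∀ e {K L A B} → L ≤ e + K → A ≈[ K ] B → shift e A ≈[ L ] shift e B
  shift-cong e L≤ A≈B = mod (go e L≤ A≈B)
    where
    go : ∀ e {K L A B n} → L ≤ e + K → A ≈[ K ] B → n ≤ L → shift e A n ≡ shift e B n
    go zero    L≤K       A≈B n≤L = _≈[_]_.coeff A≈B (ℕ.≤-trans n≤L L≤K)
    go (suc e) {n = zero}  _ A≈B n≤L = refl
    go (suc e) {n = suc n} L≤ A≈B n<L = go e (ℕ.≤-pred (ℕ.≤-trans n<L L≤)) A≈B ℕ.≤-refl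

  -- Multiplication by q^e gains e orders of precision. This gain rescues the outer terms in the
  -- limit of the finite triple product.
  mono-⊛-cong : ∀ c e {K L A B} → L ≤ e + K → A ≈[ K ] B → mono c e ⊛ A ≈[ L ] mono c e ⊛ B
  mono-⊛-cong c e {A = A} {B} L≤ A≈B = mod λ {n} n≤L → trans (mono-⊛ c e A n)
    (trans (cong (c ℤ.*_) (_≈[_]_.coeff (shift-cong e L≤ A≈B) n≤L)) (sym (mono-⊛ c e B n)))

  mono-cong : ∀ {K c d e g} → c ≡ d → e ≡ g → mono c e ≈[ K ] mono d g
  mono-cong refl refl = mod λ _ → refl

∏ : (ℕ → Series) → ℕ → Series
∏ u zero    = 1#
∏ u (suc n) = ∏ u n ⊛ u n

module Mod (K : ℕ) where
  open CommutativeSemiring (seriesMod K) public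
    using ( +-cong; +-congˡ; +-congʳ; +-identityˡ; +-identityʳ; +-assoc; +-comm
          ; *-cong; *-congˡ; *-congʳ; *-identityˡ; *-identityʳ; *-assoc; *-comm; zeroˡ; zeroʳ; distribˡ; distribʳ; _≈_; reflexive)
    renaming (refl to ≈-refl; sym to ≈-sym; trans to ≈-trans)
  open SemiringSolver (seriesMod K) public using (solve; _:+_; _:*_; _:=_; con)
  open SetoidReasoning (CommutativeSemiring.setoid (seriesMod K)) public
  module ·-Solver = CommutativeMonoidSolver (CommutativeSemiring.*-commutativeMonoid (seriesMod K))

-- Gaussian binomial coefficients

-- Σ F m k over the pairs with m + k = L
antidiag : (ℕ → ℕ → Series) → ℕ → Series
antidiag F zero    = F 0 0
antidiag F (suc L) = F (suc L) 0 ⊕ antidiag (λ m k → F m (suc k)) L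

module Gaussian (r : ℕ) where

  -- In Pochhammer notation `∏ w n` is (q^r; q^r)_n, which takes the place of a factorial in base
  -- q^r.
  Q w : ℕ → Series
  Q m = mono 1ℤ (r * m)
  w m = 1# ⊕ mono -1ℤ (r * suc m)

  -- gauss m k is the Gaussian binomial coefficient [m+k, k] in the base q^r.
  gauss : ℕ → ℕ → Series
  gauss zero    k       = 1#
  gauss (suc m) zero    = 1#
  gauss (suc m) (suc k) = gauss (suc m) k ⊕ Q (suc k) ⊛ gauss m (suc k)

module GaussianBinomial (K r : ℕ) where
  open Mod K
  open Gaussian r public

  Q-+ : ∀ m n → Q m ⊛ Q n ≈ Q (m + n)
  Q-+ m n = ≈-trans (mono-*-mono 1ℤ (r * m) 1ℤ (r * n)) (mono-cong refl (sym (ℕ.*-distribˡ-+ r m n)))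

  Q0≈1 : Q 0 ≈ 1#
  Q0≈1 = ≈-trans (mono-cong refl (ℕ.*-zeroʳ r)) mono-1-0

  -- This is (1 - x) + x(1 - y) = 1 - xy with x = q^(r(k+1)) and y = q^(r(m+1)). It merges the two
  -- Pascal summands in `gauss-∏`.
  w-+ : ∀ k m → w k ⊕ Q (suc k) ⊛ w m ≈ w (suc (m + k))
  w-+ k m = begin
    w k ⊕ Q (suc k) ⊛ w m
      ≈⟨ solve 4 (λ o x y z → (o :+ x) :+ y :* (o :+ z) := o :+ (x :+ y :* o :+ y :* z))
            ≈-refl 1# (mono -1ℤ (r * suc k)) (Q (suc k)) (mono -1ℤ (r * suc m)) ⟩
    1# ⊕ (mono -1ℤ (r * suc k) ⊕ Q (suc k) ⊛ 1# ⊕ Q (suc k) ⊛ mono -1ℤ (r * suc m))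
      ≈⟨ +-congˡ (+-cong (+-congˡ (*-identityʳ (Q (suc k)))) (mono-*-mono 1ℤ (r * suc k) -1ℤ (r * suc m))) ⟩
    1# ⊕ (mono -1ℤ (r * suc k) ⊕ Q (suc k) ⊕ mono -1ℤ (r * suc k + r * suc m))
      ≈⟨ +-congˡ (+-cong cancel (mono-cong refl exponents)) ⟩
    1# ⊕ (0# ⊕ mono -1ℤ (r * suc (suc (m + k)))) ≈⟨ +-congˡ (+-identityˡ _) ⟩
    w (suc (m + k)) ∎
    where
    cancel : mono -1ℤ (r * suc k) ⊕ Q (suc k) ≈ 0#
    cancel = ≈-trans (mono-⊕-mono -1ℤ 1ℤ (r * suc k)) (mono-0 (r * suc k))
    exponents : r * suc k + r * suc m ≡ r * suc (suc (m + k))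
    exponents = trans (sym (ℕ.*-distribˡ-+ r (suc k) (suc m)))
      (cong (r *_) (cong suc (trans (ℕ.+-suc k m) (cong suc (ℕ.+-comm k m)))))

  gauss-m-0 : ∀ m → gauss m 0 ≈ 1#
  gauss-m-0 zero    = ≈-refl
  gauss-m-0 (suc m) = ≈-refl

  -- Gaussian coefficients obey two Pascal rules, exchanged by the symmetry of m and k. One defines
  -- `gauss`; the other follows by induction. The triple product needs both, one for each of its two
  -- products.
  gauss-pascal : ∀ m k → gauss (suc m) (suc k) ≈ Q (suc m) ⊛ gauss (suc m) k ⊕ gauss m (suc k)
  gauss-pascal zero zero = solve 2 (λ x y → x :+ y :* x := y :* x :+ x) ≈-refl 1# (Q 1)
  gauss-pascal zero (suc k) = begin
    gauss 1 (suc k) ⊕ Q (2 + k) ⊛ 1# ≈⟨ +-congʳ (gauss-pascal zero k) ⟩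
    Q 1 ⊛ gauss 1 k ⊕ 1# ⊕ Q (2 + k) ⊛ 1# ≈⟨ +-congˡ (*-congʳ (≈-sym (Q-+ 1 (suc k)))) ⟩
    Q 1 ⊛ gauss 1 k ⊕ 1# ⊕ Q 1 ⊛ Q (suc k) ⊛ 1#
      ≈⟨ solve 4 (λ a b o x → a :* x :+ o :+ a :* b :* o := a :* (x :+ b :* o) :+ o)
            ≈-refl (Q 1) (Q (suc k)) 1# (gauss 1 k) ⟩
    Q 1 ⊛ gauss 1 (suc k) ⊕ 1# ∎
  gauss-pascal (suc m) zero = begin
    1# ⊕ Q 1 ⊛ gauss (suc m) 1 ≈⟨ +-congˡ (*-congˡ (gauss-pascal m 0)) ⟩
    1# ⊕ Q 1 ⊛ (Q (suc m) ⊛ 1# ⊕ gauss m 1)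
      ≈⟨ solve 4 (λ a b o x → o :+ a :* (b :* o :+ x) := a :* b :* o :+ (o :+ a :* x))
            ≈-refl (Q 1) (Q (suc m)) 1# (gauss m 1) ⟩
    Q 1 ⊛ Q (suc m) ⊛ 1# ⊕ gauss (suc m) 1 ≈⟨ +-congʳ (*-congʳ (Q-+ 1 (suc m))) ⟩
    Q (2 + m) ⊛ 1# ⊕ gauss (suc m) 1 ∎
  gauss-pascal (suc m) (suc k) = begin
    gauss (2 + m) (suc k) ⊕ Q (2 + k) ⊛ gauss (suc m) (2 + k)
      ≈⟨ +-cong (gauss-pascal (suc m) k) (*-congˡ (gauss-pascal m (suc k))) ⟩
    (Q (2 + m) ⊛ gauss (2 + m) k ⊕ gauss (suc m) (suc k)) ⊕ Q (2 + k) ⊛ (Q (suc m) ⊛ gauss (suc m) (suc k)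
          ⊕ gauss m (2 + k))
      ≈⟨ solve 6 (λ a b c x y z → (a :* x :+ y) :+ b :* (c :* y :+ z) := a :* x :+ (y :+ b :* c :* y :+ b :* z))
            ≈-refl
           (Q (2 + m)) (Q (2 + k)) (Q (suc m)) (gauss (2 + m) k) (gauss (suc m) (suc k)) (gauss m (2 + k)) ⟩
    Q (2 + m) ⊛ gauss (2 + m) k ⊕ (gauss (suc m) (suc k) ⊕ Q (2 + k) ⊛ Q (suc m) ⊛ gauss (suc m) (suc k)
          ⊕ Q (2 + k) ⊛ gauss m (2 + k))
      ≈⟨ +-congˡ (+-congʳ (+-congˡ (*-congʳ swap))) ⟩
    Q (2 + m) ⊛ gauss (2 + m) k ⊕ (gauss (suc m) (suc k) ⊕ Q (2 + m) ⊛ Q (suc k) ⊛ gauss (suc m) (suc k)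
          ⊕ Q (2 + k) ⊛ gauss m (2 + k))
      ≈⟨ solve 6 (λ a b c x y z → a :* x :+ (y :+ a :* b :* y :+ c :* z) := a :* (x :+ b :* y) :+ (y :+ c :* z))
            ≈-refl
           (Q (2 + m)) (Q (suc k)) (Q (2 + k)) (gauss (2 + m) k) (gauss (suc m) (suc k)) (gauss m (2 + k)) ⟩
    Q (2 + m) ⊛ gauss (2 + m) (suc k) ⊕ gauss (suc m) (2 + k) ∎
    where
    swap : Q (2 + k) ⊛ Q (suc m) ≈ Q (2 + m) ⊛ Q (suc k)
    swap = ≈-trans (Q-+ (2 + k) (suc m)) (≈-trans (mono-cong refl (cong
          (λ n → r * suc n) (ℕ.+-comm (suc k) (suc m)))) (≈-sym (Q-+ (2 + m) (suc k))))

  -- The quotient formula for a Gaussian coefficient, cleared of denominators. It is the only access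
  -- to the limit of `gauss m k`.
  gauss-∏ : ∀ m k → gauss m k ⊛ (∏ w m ⊛ ∏ w k) ≈ ∏ w (m + k)
  gauss-∏ zero    k    = ≈-trans (*-identityˡ (1# ⊛ ∏ w k)) (*-identityˡ (∏ w k))
  gauss-∏ (suc m) zero = ≈-trans (*-identityˡ (∏ w (suc m) ⊛ 1#)) (≈-trans (*-identityʳ
        (∏ w (suc m))) (reflexive (cong (∏ w) (sym (ℕ.+-identityʳ (suc m))))))
  gauss-∏ (suc m) (suc k) = begin
    (gauss (suc m) k ⊕ Q (suc k) ⊛ gauss m (suc k)) ⊛ (∏ w m ⊛ w m ⊛ (∏ w k ⊛ w k))
      ≈⟨ solve 7 (λ x b y p a p′ c → (x :+ b :* y) :* (p :* a :* (p′ :* c))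
           := (x :* (p :* a :* p′)) :* c :+ b :* a :* (y :* (p :* (p′ :* c)))) ≈-refl
           (gauss (suc m) k) (Q (suc k)) (gauss m (suc k)) (∏ w m) (w m) (∏ w k) (w k) ⟩
    (gauss (suc m) k ⊛ (∏ w (suc m) ⊛ ∏ w k)) ⊛ w k ⊕ Q (suc k) ⊛ w m ⊛ (gauss m (suc k) ⊛ (∏ w m ⊛ ∏ w (suc k)))
      ≈⟨ +-cong (*-congʳ (gauss-∏ (suc m) k)) (*-congˡ (≈-trans (gauss-∏ m (suc k)) (reflexive (cong
            (∏ w) (ℕ.+-suc m k))))) ⟩
    ∏ w (suc (m + k)) ⊛ w k ⊕ Q (suc k) ⊛ w m ⊛ ∏ w (suc (m + k))
      ≈⟨ solve 3 (λ p x y → p :* x :+ y :* p := p :* (x :+ y))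
            ≈-refl (∏ w (suc (m + k))) (w k) (Q (suc k) ⊛ w m) ⟩
    ∏ w (suc (m + k)) ⊛ (w k ⊕ Q (suc k) ⊛ w m) ≈⟨ *-congˡ (w-+ k m) ⟩
    ∏ w (suc (suc (m + k))) ≈⟨ reflexive (cong (∏ w) (cong suc (sym (ℕ.+-suc m k)))) ⟩
    ∏ w (suc m + suc k) ∎

antidiag-cong : ∀ {K} {F G : ℕ → ℕ → Series} L → (∀ m k → m + k ≡ L → F m k ≈[ K ] G m k) →
                antidiag F L ≈[ K ] antidiag G L
antidiag-cong zero    F≈G = F≈G 0 0 refl
antidiag-cong {K} (suc L) F≈G = +-cong (F≈G (suc L) 0 (ℕ.+-identityʳ _))
  (antidiag-cong L λ m k m+k≡L → F≈G m (suc k) (trans (ℕ.+-suc m k) (cong suc m+k≡L)))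
  where open Mod K

⊛-antidiag : ∀ {K} A (F : ℕ → ℕ → Series) L → A ⊛ antidiag F L ≈[ K ] antidiag (λ m k → A ⊛ F m k) L
⊛-antidiag {K} A F zero    = Mod.≈-refl K
⊛-antidiag {K} A F (suc L) = ≈-trans (distribˡ A (F (suc L) 0) _) (+-congˡ (⊛-antidiag A _ L))
  where open Mod K

-- As in Pascal's triangle, an entry of level L + 1 collects from two neighbours of level L, and an
-- entry on the edge from only one. Hence each entry of level L is counted once in `H₁` and once in
-- `H₂`.
antidiag-pascal : ∀ {K} (G H₁ H₂ : ℕ → ℕ → Series) →
  (∀ k → G 0 (suc k) ≈[ K ] H₁ 0 k) →
  (∀ m → G (suc m) 0 ≈[ K ] H₂ m 0) →
  (∀ m k → G (suc m) (suc k) ≈[ K ] H₁ (suc m) k ⊕ H₂ m (suc k)) →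
  ∀ L → antidiag G (suc L) ≈[ K ] antidiag H₁ L ⊕ antidiag H₂ L
antidiag-pascal {K} G H₁ H₂ G₀ Gₛ₀ Gₛₛ L =
  ≈-trans (+-comm (G (suc L) 0) _) (≈-trans (+-congˡ (Gₛ₀ L)) (go G H₁ H₂ G₀ Gₛₛ L))
  where
  open Mod K
  -- The induction shifts k, which would not preserve the condition on the edge `G (suc m) 0`; the
  -- edge contribution `H₂ L 0` therefore stands on the left instead.
  go : ∀ G H₁ H₂ → (∀ k → G 0 (suc k) ≈ H₁ 0 k) →
       (∀ m k → G (suc m) (suc k) ≈ H₁ (suc m) k ⊕ H₂ m (suc k)) →
       ∀ L → antidiag (λ m k → G m (suc k)) L ⊕ H₂ L 0 ≈ antidiag H₁ L ⊕ antidiag H₂ L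
  go G H₁ H₂ G₀ Gₛₛ zero    = +-congʳ (G₀ 0)
  go G H₁ H₂ G₀ Gₛₛ (suc L) = begin
    (G (suc L) 1 ⊕ antidiag (λ m k → G m (suc (suc k))) L) ⊕ H₂ (suc L) 0
      ≈⟨ +-congʳ (+-congʳ (Gₛₛ L 0)) ⟩
    (H₁ (suc L) 0 ⊕ H₂ L 1 ⊕ antidiag (λ m k → G m (suc (suc k))) L) ⊕ H₂ (suc L) 0
      ≈⟨ solve 4 (λ x y z t → (x :+ y :+ z) :+ t := (x :+ t) :+ (z :+ y))
            ≈-refl (H₁ (suc L) 0) (H₂ L 1) _ (H₂ (suc L) 0) ⟩
    (H₁ (suc L) 0 ⊕ H₂ (suc L) 0) ⊕ (antidiag (λ m k → G m (suc (suc k))) L ⊕ H₂ L 1)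
      ≈⟨ +-congˡ (go (λ m k → G m (suc k)) (λ m k → H₁ m (suc k)) (λ m k → H₂ m (suc k)) (λ k → G₀ (suc k))
            (λ m k → Gₛₛ m (suc k)) L) ⟩
    (H₁ (suc L) 0 ⊕ H₂ (suc L) 0) ⊕ (antidiag (λ m k → H₁ m (suc k)) L ⊕ antidiag (λ m k → H₂ m (suc k)) L)
      ≈⟨ solve 4 (λ x y z t → (x :+ y) :+ (z :+ t) := (x :+ z) :+ (y :+ t))
            ≈-refl (H₁ (suc L) 0) (H₂ (suc L) 0) _ _ ⟩
    antidiag H₁ (suc L) ⊕ antidiag H₂ (suc L) ∎

-- The finite triple product

tri : ℕ → ℕ
tri zero    = 0
tri (suc n) = suc n + tri n

-- T n = n(n+1)/2
T : ℤ → ℕ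
T (+ n)    = tri n
T -[1+ n ] = tri n

2*tri : ∀ n → + 2 ℤ.* + tri n ≡ + n ℤ.* + n ℤ.+ + n
2*tri zero    = refl
2*tri (suc n) = trans (lemma₁ (+ n) (+ tri n)) (trans (cong (λ x → + 2 ℤ.+ + 2 ℤ.* + n ℤ.+ x) (2*tri n)) (lemma₂ (+ n)))
  where
  lemma₁ : ∀ n t → + 2 ℤ.* (1ℤ ℤ.+ n ℤ.+ t) ≡ + 2 ℤ.+ + 2 ℤ.* n ℤ.+ + 2 ℤ.* t
  lemma₁ = solve-∀
  lemma₂ : ∀ n → + 2 ℤ.+ + 2 ℤ.* n ℤ.+ (n ℤ.* n ℤ.+ n) ≡ (1ℤ ℤ.+ n) ℤ.* (1ℤ ℤ.+ n) ℤ.+ (1ℤ ℤ.+ n)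
  lemma₂ = solve-∀

2*T : ∀ n → + 2 ℤ.* + T n ≡ n ℤ.* n ℤ.+ n
2*T (+ n)    = 2*tri n
2*T -[1+ n ] = trans (2*tri n) (lemma (+ n))
  where
  lemma : ∀ n → n ℤ.* n ℤ.+ n ≡ ℤ.- (1ℤ ℤ.+ n) ℤ.* ℤ.- (1ℤ ℤ.+ n) ℤ.+ ℤ.- (1ℤ ℤ.+ n)
  lemma = solve-∀

n≤tri : ∀ n → n ≤ tri n
n≤tri zero    = z≤n
n≤tri (suc n) = ℕ.m≤m+n (suc n) (tri n)

-- The exponent of q in the n-th term of f(±q^i, ±q^j); `T (ℤ.pred n)` is n(n-1)/2.
exponent : ℕ → ℕ → ℤ → ℕ
exponent i j n = i * T n + j * T (ℤ.pred n)

-- Doubling clears the halves in the triangular numbers, so that relations between exponents become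
-- polynomial identities over the integers.
2*exponent : ∀ i j n → + 2 ℤ.* + exponent i j n ≡ + i ℤ.* (n ℤ.* n ℤ.+ n) ℤ.+ + j ℤ.* (n ℤ.* n ℤ.- n)
2*exponent i j n = begin
  + 2 ℤ.* + (i * T n + j * T (ℤ.pred n))
    ≡⟨ cong (λ x → + 2 ℤ.* x) (cong₂ ℤ._+_ (ℤ.pos-* i _) (ℤ.pos-* j _)) ⟩
  + 2 ℤ.* (+ i ℤ.* + T n ℤ.+ + j ℤ.* + T (ℤ.pred n))
    ≡⟨ lemma₁ (+ i) (+ j) (+ T n) (+ T (ℤ.pred n)) ⟩
  + i ℤ.* (+ 2 ℤ.* + T n) ℤ.+ + j ℤ.* (+ 2 ℤ.* + T (ℤ.pred n))
    ≡⟨ cong₂ (λ x y → + i ℤ.* x ℤ.+ + j ℤ.* y) (2*T n) (trans (2*T (ℤ.pred n)) (lemma₂ n)) ⟩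
  + i ℤ.* (n ℤ.* n ℤ.+ n) ℤ.+ + j ℤ.* (n ℤ.* n ℤ.- n) ∎
  where
  open ≡-Reasoning
  lemma₁ : ∀ i j x y → + 2 ℤ.* (i ℤ.* x ℤ.+ j ℤ.* y) ≡ i ℤ.* (+ 2 ℤ.* x) ℤ.+ j ℤ.* (+ 2 ℤ.* y)
  lemma₁ = solve-∀
  lemma₂ : ∀ n → (-1ℤ ℤ.+ n) ℤ.* (-1ℤ ℤ.+ n) ℤ.+ (-1ℤ ℤ.+ n) ≡ n ℤ.* n ℤ.- n
  lemma₂ = solve-∀

exponent-suc : ∀ i j n → + exponent i j (1ℤ ℤ.+ n) ≡ + exponent i j n ℤ.+ (+ i ℤ.* (1ℤ ℤ.+ n) ℤ.+ + j ℤ.* n)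
exponent-suc i j n = ℤ.*-cancelˡ-≡ (+ 2) _ _ (begin
  + 2 ℤ.* + exponent i j (1ℤ ℤ.+ n)
    ≡⟨ 2*exponent i j (1ℤ ℤ.+ n) ⟩
  + i ℤ.* ((1ℤ ℤ.+ n) ℤ.* (1ℤ ℤ.+ n) ℤ.+ (1ℤ ℤ.+ n)) ℤ.+ + j ℤ.* ((1ℤ ℤ.+ n) ℤ.* (1ℤ ℤ.+ n) ℤ.- (1ℤ ℤ.+ n))
    ≡⟨ lemma (+ i) (+ j) n ⟩
  + i ℤ.* (n ℤ.* n ℤ.+ n) ℤ.+ + j ℤ.* (n ℤ.* n ℤ.- n) ℤ.+ + 2 ℤ.* (+ i ℤ.* (1ℤ ℤ.+ n) ℤ.+ + j ℤ.* n)
    ≡⟨ cong (ℤ._+ + 2 ℤ.* (+ i ℤ.* (1ℤ ℤ.+ n) ℤ.+ + j ℤ.* n)) (2*exponent i j n) ⟨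
  + 2 ℤ.* + exponent i j n ℤ.+ + 2 ℤ.* (+ i ℤ.* (1ℤ ℤ.+ n) ℤ.+ + j ℤ.* n)
    ≡⟨ ℤ.*-distribˡ-+ (+ 2) (+ exponent i j n) _ ⟨
  + 2 ℤ.* (+ exponent i j n ℤ.+ (+ i ℤ.* (1ℤ ℤ.+ n) ℤ.+ + j ℤ.* n)) ∎)
  where
  open ≡-Reasoning
  lemma : ∀ i j n →
    i ℤ.* ((1ℤ ℤ.+ n) ℤ.* (1ℤ ℤ.+ n) ℤ.+ (1ℤ ℤ.+ n)) ℤ.+ j ℤ.* ((1ℤ ℤ.+ n) ℤ.* (1ℤ ℤ.+ n) ℤ.- (1ℤ ℤ.+ n))
    ≡ i ℤ.* (n ℤ.* n ℤ.+ n) ℤ.+ j ℤ.* (n ℤ.* n ℤ.- n) ℤ.+ + 2 ℤ.* (i ℤ.* (1ℤ ℤ.+ n) ℤ.+ j ℤ.* n)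
  lemma = solve-∀

-- This growth makes theta series finite modulo q^(K+1): indices with absolute value above K drop
-- out.
∣n∣≤exponent : ∀ i j .{{_ : NonZero i}} .{{_ : NonZero j}} n → ∣ n ∣ ≤ exponent i j n
∣n∣≤exponent i j (+ n)    = ℕ.≤-trans (n≤tri n) (ℕ.≤-trans (ℕ.m≤n*m (tri n) i) (ℕ.m≤m+n _ _))
∣n∣≤exponent i j -[1+ n ] = ℕ.≤-trans (n≤tri (suc n)) (ℕ.≤-trans (ℕ.m≤n*m (tri (suc n)) j) (ℕ.m≤n+m _ _))

suc-⊖ : ∀ k N → suc k ⊖ N ≡ 1ℤ ℤ.+ (k ⊖ N)
suc-⊖ k N = sym (ℤ.distribʳ-⊖-+-pos 1 k N)

∏-cong : ∀ {K} {u v : ℕ → Series} n → (∀ k → u k ≈[ K ] v k) → ∏ u n ≈[ K ] ∏ v n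
∏-cong {K} zero    u≈v = Mod.≈-refl K
∏-cong     (suc n) u≈v = ⊛-cong (∏-cong n u≈v) (u≈v n)

binomial : ℤ → ℕ → ℕ → ℕ → Series
binomial ε i r k = 1# ⊕ mono ε (i + r * k)

module Sign (ε : ℤ) (ε*ε≡1 : ε ℤ.* ε ≡ 1ℤ) where

  -- This is ε^n for negative n too, because ε is its own inverse.
  sgn : ℤ → ℤ
  sgn n = ε ℤ.^ ∣ n ∣

  ε-cancel : ∀ {x y} → ε ℤ.* x ≡ y → x ≡ ε ℤ.* y
  ε-cancel {x} {y} εx≡y = begin
    x               ≡⟨ ℤ.*-identityˡ x ⟨
    1ℤ ℤ.* x        ≡⟨ cong (ℤ._* x) ε*ε≡1 ⟨
    ε ℤ.* ε ℤ.* x   ≡⟨ ℤ.*-assoc ε ε x ⟩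
    ε ℤ.* (ε ℤ.* x) ≡⟨ cong (ε ℤ.*_) εx≡y ⟩
    ε ℤ.* y         ∎
    where open ≡-Reasoning

  sgn-suc : ∀ n → sgn (1ℤ ℤ.+ n) ≡ ε ℤ.* sgn n
  sgn-suc (+ n)    = refl
  sgn-suc -[1+ n ] = ε-cancel (cong (λ m → ε ℤ.* ε ℤ.^ m) (ℤ.∣⊖∣-≤ {1} {suc n} (s≤s z≤n)))

  sgn-+ : ∀ m n → sgn (m ℤ.+ n) ≡ sgn m ℤ.* sgn n
  sgn-+ (+ zero)       n = trans (cong sgn (ℤ.+-identityˡ n)) (sym (ℤ.*-identityˡ _))
  sgn-+ (+ suc m)      n = begin
    sgn (1ℤ ℤ.+ + m ℤ.+ n)   ≡⟨ cong sgn (ℤ.+-assoc 1ℤ (+ m) n) ⟩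
    sgn (1ℤ ℤ.+ (+ m ℤ.+ n)) ≡⟨ sgn-suc (+ m ℤ.+ n) ⟩
    ε ℤ.* sgn (+ m ℤ.+ n)    ≡⟨ cong (ε ℤ.*_) (sgn-+ (+ m) n) ⟩
    ε ℤ.* (sgn (+ m) ℤ.* sgn n) ≡⟨ ℤ.*-assoc ε _ _ ⟨
    sgn (+ suc m) ℤ.* sgn n  ∎
    where open ≡-Reasoning
  sgn-+ -[1+ m ]       n = ε-cancel-both (begin
    ε ℤ.* sgn (-[1+ m ] ℤ.+ n)         ≡⟨ sgn-suc (-[1+ m ] ℤ.+ n) ⟨
    sgn (1ℤ ℤ.+ (-[1+ m ] ℤ.+ n))      ≡⟨ cong sgn (ℤ.+-assoc 1ℤ -[1+ m ] n) ⟨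
    sgn (1ℤ ℤ.+ -[1+ m ] ℤ.+ n)        ≡⟨ previous m ⟩
    sgn (1ℤ ℤ.+ -[1+ m ]) ℤ.* sgn n    ≡⟨ cong (ℤ._* sgn n) (sgn-suc -[1+ m ]) ⟩
    ε ℤ.* sgn -[1+ m ] ℤ.* sgn n       ≡⟨ ℤ.*-assoc ε _ _ ⟩
    ε ℤ.* (sgn -[1+ m ] ℤ.* sgn n)     ∎)
    where
    open ≡-Reasoning
    ε-cancel-both : ∀ {x y} → ε ℤ.* x ≡ ε ℤ.* y → x ≡ y
    ε-cancel-both εx≡εy = trans (ε-cancel εx≡εy) (sym (ε-cancel refl))
    previous : ∀ m → sgn (1ℤ ℤ.+ -[1+ m ] ℤ.+ n) ≡ sgn (1ℤ ℤ.+ -[1+ m ]) ℤ.* sgn n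
    previous zero    = sgn-+ (+ 0) n
    previous (suc m) = sgn-+ -[1+ m ] n

module TripleProduct (ε : ℤ) (ε*ε≡1 : ε ℤ.* ε ≡ 1ℤ) (i j : ℕ) where
  open Sign ε ε*ε≡1 public

  r : ℕ
  r = i + j

  e : ℤ → ℕ
  e = exponent i j

  -- The n-th term of f(ε q^i, ε q^j): the sign is ε to the power n(n+1)/2 + n(n-1)/2 = n², which
  -- has the parity of n.
  term : ℤ → Series
  term n = mono (sgn n) (e n)

  -- With n = k - N, passing to n + 1 raises the exponent by i(1 + n) + jn. The hypothesis gives n =
  -- M - m, so this increase is exactly i + rM - rm.
  exponent-⊖-suc : ∀ {m k M N} → m + k ≡ M + N → i + r * M + e (k ⊖ N) ≡ r * m + e (suc k ⊖ N)
  exponent-⊖-suc {m} {k} {M} {N} m+k≡M+N = ℤ.+-injective (begin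
    + (i + r * M) ℤ.+ + e (k ⊖ N)
      ≡⟨ cong (λ x → + i ℤ.+ x ℤ.+ + e (k ⊖ N)) (ℤ.pos-* r M) ⟩
    + i ℤ.+ (+ i ℤ.+ + j) ℤ.* + M ℤ.+ + e (k ⊖ N)
      ≡⟨ lemma (+ i) (+ j) (+ m) (+ M) (+ e (k ⊖ N)) ⟩
    (+ i ℤ.+ + j) ℤ.* + m ℤ.+ (+ e (k ⊖ N) ℤ.+ (+ i ℤ.* (1ℤ ℤ.+ (+ M ℤ.- + m)) ℤ.+ + j ℤ.* (+ M ℤ.- + m)))
      ≡⟨ cong (λ n → + r ℤ.* + m ℤ.+ (+ e (k ⊖ N) ℤ.+ (+ i ℤ.* (1ℤ ℤ.+ n) ℤ.+ + j ℤ.* n))) k⊖N≡M-m ⟨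
    + r ℤ.* + m ℤ.+ (+ e (k ⊖ N) ℤ.+ (+ i ℤ.* (1ℤ ℤ.+ (k ⊖ N)) ℤ.+ + j ℤ.* (k ⊖ N)))
      ≡⟨ cong₂ ℤ._+_ (ℤ.pos-* r m) (trans (cong (λ n → + e n) (suc-⊖ k N)) (exponent-suc i j (k ⊖ N))) ⟨
    + (r * m) ℤ.+ + e (suc k ⊖ N) ∎)
    where
    open ≡-Reasoning
    lemma : ∀ i j m M x → i ℤ.+ (i ℤ.+ j) ℤ.* M ℤ.+ x ≡ (i ℤ.+ j) ℤ.* m ℤ.+ (x ℤ.+ (i ℤ.* (1ℤ
          ℤ.+ (M ℤ.- m)) ℤ.+ j ℤ.* (M ℤ.- m)))
    lemma = solve-∀
    k⊖N≡M-m : k ⊖ N ≡ + M ℤ.- + m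
    k⊖N≡M-m = trans (sym (ℤ.m-n≡m⊖n k N)) (trans (lemma₁ (+ m) (+ k) (+ N))
      (trans (cong (λ x → + x ℤ.- + N ℤ.- + m) m+k≡M+N) (lemma₂ (+ m) (+ M) (+ N))))
      where
      lemma₁ : ∀ m k N → k ℤ.- N ≡ (m ℤ.+ k) ℤ.- N ℤ.- m
      lemma₁ = solve-∀
      lemma₂ : ∀ m M N → (M ℤ.+ N) ℤ.- N ℤ.- m ≡ M ℤ.- m
      lemma₂ = solve-∀

  exponent-⊖-pred : ∀ k N → j + r * N + e (k ⊖ N) ≡ r * k + e (k ⊖ suc N)
  exponent-⊖-pred k N = ℤ.+-injective (begin
    + (j + r * N) ℤ.+ + e (k ⊖ N)
      ≡⟨ cong₂ (λ x y → + j ℤ.+ x ℤ.+ y) (ℤ.pos-* r N) (trans (cong (λ n → + e n) k⊖N≡1+n) (exponent-suc i j n)) ⟩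
    + j ℤ.+ (+ i ℤ.+ + j) ℤ.* + N ℤ.+ (+ e n ℤ.+ (+ i ℤ.* (1ℤ ℤ.+ n) ℤ.+ + j ℤ.* n))
      ≡⟨ cong (λ m → + j ℤ.+ (+ i ℤ.+ + j) ℤ.* + N ℤ.+ (+ e n ℤ.+ (+ i ℤ.* (1ℤ ℤ.+ m) ℤ.+ + j ℤ.* m)))
            (ℤ.m-n≡m⊖n k (suc N)) ⟨
    + j ℤ.+ (+ i ℤ.+ + j) ℤ.* + N ℤ.+ (+ e n ℤ.+ (+ i ℤ.* (1ℤ
          ℤ.+ (+ k ℤ.- (1ℤ ℤ.+ + N))) ℤ.+ + j ℤ.* (+ k ℤ.- (1ℤ ℤ.+ + N))))
      ≡⟨ lemma (+ i) (+ j) (+ k) (+ N) (+ e n) ⟩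
    (+ i ℤ.+ + j) ℤ.* + k ℤ.+ + e n
      ≡⟨ cong (ℤ._+ + e n) (ℤ.pos-* r k) ⟨
    + (r * k) ℤ.+ + e n ∎)
    where
    open ≡-Reasoning
    lemma : ∀ i j k N x → j ℤ.+ (i ℤ.+ j) ℤ.* N ℤ.+ (x ℤ.+ (i ℤ.* (1ℤ
          ℤ.+ (k ℤ.- (1ℤ ℤ.+ N))) ℤ.+ j ℤ.* (k ℤ.- (1ℤ ℤ.+ N)))) ≡ (i ℤ.+ j) ℤ.* k ℤ.+ x
    lemma = solve-∀
    n : ℤ
    n = k ⊖ suc N
    k⊖N≡1+n : k ⊖ N ≡ 1ℤ ℤ.+ n
    k⊖N≡1+n = trans (sym (ℤ.[1+m]⊖[1+n]≡m⊖n k N)) (suc-⊖ k (suc N))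

  module _ (K : ℕ) where
    open Mod K
    open GaussianBinomial K r

    term-suc : ∀ {m k M N} → m + k ≡ M + N →
      mono ε (i + r * M) ⊛ term (k ⊖ N) ≈ Q m ⊛ term (suc k ⊖ N)
    term-suc {m} {k} {M} {N} m+k≡M+N = begin
      mono ε (i + r * M) ⊛ term (k ⊖ N) ≈⟨ mono-*-mono ε (i + r * M) (sgn (k ⊖ N)) (e (k ⊖ N)) ⟩
      mono (ε ℤ.* sgn (k ⊖ N)) (i + r * M + e (k ⊖ N))
        ≈⟨ mono-cong signs (exponent-⊖-suc {m} {k} {M} {N} m+k≡M+N) ⟩
      mono (1ℤ ℤ.* sgn (suc k ⊖ N)) (r * m + e (suc k ⊖ N))
        ≈⟨ mono-*-mono 1ℤ (r * m) (sgn (suc k ⊖ N)) (e (suc k ⊖ N)) ⟨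
      Q m ⊛ term (suc k ⊖ N) ∎
      where
      signs : ε ℤ.* sgn (k ⊖ N) ≡ 1ℤ ℤ.* sgn (suc k ⊖ N)
      signs = trans (sym (sgn-suc (k ⊖ N))) (trans (cong sgn (sym (suc-⊖ k N))) (sym (ℤ.*-identityˡ _)))

    term-pred : ∀ k N → mono ε (j + r * N) ⊛ term (k ⊖ N) ≈ Q k ⊛ term (k ⊖ suc N)
    term-pred k N = begin
      mono ε (j + r * N) ⊛ term (k ⊖ N) ≈⟨ mono-*-mono ε (j + r * N) (sgn (k ⊖ N)) (e (k ⊖ N)) ⟩
      mono (ε ℤ.* sgn (k ⊖ N)) (j + r * N + e (k ⊖ N)) ≈⟨ mono-cong signs (exponent-⊖-pred k N) ⟩
      mono (1ℤ ℤ.* sgn (k ⊖ suc N)) (r * k + e (k ⊖ suc N))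
        ≈⟨ mono-*-mono 1ℤ (r * k) (sgn (k ⊖ suc N)) (e (k ⊖ suc N)) ⟨
      Q k ⊛ term (k ⊖ suc N) ∎
      where
      n : ℤ
      n = k ⊖ suc N
      k⊖N≡1+n : k ⊖ N ≡ 1ℤ ℤ.+ n
      k⊖N≡1+n = trans (sym (ℤ.[1+m]⊖[1+n]≡m⊖n k N)) (suc-⊖ k (suc N))
      signs : ε ℤ.* sgn (k ⊖ N) ≡ 1ℤ ℤ.* sgn n
      signs = trans (cong (ε ℤ.*_) (trans (cong sgn k⊖N≡1+n) (sgn-suc n)))
        (trans (sym (ℤ.*-assoc ε ε _)) (cong (ℤ._* sgn n) ε*ε≡1))

    binomial-⊛ : ∀ i k A → binomial ε i r k ⊛ A ≈ mono ε (i + r * k) ⊛ A ⊕ A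
    binomial-⊛ i k A = ≈-trans (distribʳ A 1# (mono ε (i + r * k)))
      (≈-trans (+-congʳ (*-identityˡ A)) (+-comm A _))

    -- A q-binomial theorem with its summation index centred at `N`, which tends to Jacobi's triple
    -- product. Each new factor 1 + ε q^d contributes two copies of the previous sum, recombined by
    -- a Pascal rule. A factor of the second product moves the centre and uses the recursion
    -- defining `gauss`; a factor of the first keeps the centre and uses `gauss-pascal`.
    finiteTripleProduct : ∀ M N →
      ∏ (binomial ε i r) M ⊛ ∏ (binomial ε j r) N ≈ antidiag (λ m k → gauss m k ⊛ term (k ⊖ N)) (M + N)
    finiteTripleProduct zero zero = *-congˡ (≈-sym (≈-trans (mono-cong {c = 1ℤ} refl
          (cong₂ _+_ (ℕ.*-zeroʳ i) (ℕ.*-zeroʳ j))) mono-1-0))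
    finiteTripleProduct zero (suc N) = begin
      1# ⊛ (∏ (binomial ε j r) N ⊛ binomial ε j r N)
        ≈⟨ solve 3 (λ o p x → o :* (p :* x) := x :* (o :* p))
              ≈-refl 1# (∏ (binomial ε j r) N) (binomial ε j r N) ⟩
      binomial ε j r N ⊛ (1# ⊛ ∏ (binomial ε j r) N)
        ≈⟨ *-congˡ (finiteTripleProduct zero N) ⟩
      binomial ε j r N ⊛ antidiag H₁ N
        ≈⟨ binomial-⊛ j N (antidiag H₁ N) ⟩
      mono ε (j + r * N) ⊛ antidiag H₁ N ⊕ antidiag H₁ N
        ≈⟨ +-congʳ (≈-trans (⊛-antidiag (mono ε (j + r * N)) H₁ N) (antidiag-cong N λ m k _ → swap m k)) ⟩
      antidiag H₂ N ⊕ antidiag H₁ N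
        ≈⟨ +-comm _ _ ⟩
      antidiag H₁ N ⊕ antidiag H₂ N
        ≈⟨ antidiag-pascal (λ m k → gauss m k ⊛ term (k ⊖ suc N)) H₁ H₂
             (λ k → *-congˡ (reflexive (cong term (ℤ.[1+m]⊖[1+n]≡m⊖n k N))))
             (λ m → *-cong (≈-sym (≈-trans (*-identityˡ (gauss m 0)) (gauss-m-0 m))) ≈-refl ⟨≈⟩ *-congʳ
                   (*-congʳ (≈-sym Q0≈1)))
             (λ m k → ≈-trans (distribʳ _ (gauss (suc m) k) (Q (suc k) ⊛ gauss m (suc k)))
                (+-congʳ (*-congˡ (reflexive (cong term (ℤ.[1+m]⊖[1+n]≡m⊖n k N)))))) N ⟨
      antidiag (λ m k → gauss m k ⊛ term (k ⊖ suc N)) (suc N) ∎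
      where
      infixr 1 _⟨≈⟩_
      _⟨≈⟩_ : ∀ {A B C} → A ≈ B → B ≈ C → A ≈ C
      _⟨≈⟩_ = ≈-trans
      H₁ H₂ : ℕ → ℕ → Series
      H₁ m k = gauss m k ⊛ term (k ⊖ N)
      H₂ m k = Q k ⊛ gauss m k ⊛ term (k ⊖ suc N)
      swap : ∀ m k → mono ε (j + r * N) ⊛ H₁ m k ≈ H₂ m k
      swap m k = begin
        mono ε (j + r * N) ⊛ (gauss m k ⊛ term (k ⊖ N))
          ≈⟨ solve 3 (λ a g t → a :* (g :* t) := g :* (a :* t))
                ≈-refl (mono ε (j + r * N)) (gauss m k) (term (k ⊖ N)) ⟩
        gauss m k ⊛ (mono ε (j + r * N) ⊛ term (k ⊖ N))
          ≈⟨ *-congˡ (term-pred k N) ⟩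
        gauss m k ⊛ (Q k ⊛ term (k ⊖ suc N))
          ≈⟨ solve 3 (λ a g t → g :* (a :* t) := a :* g :* t) ≈-refl (Q k) (gauss m k) (term (k ⊖ suc N)) ⟩
        H₂ m k ∎
    finiteTripleProduct (suc M) N = begin
      ∏ (binomial ε i r) M ⊛ binomial ε i r M ⊛ ∏ (binomial ε j r) N
        ≈⟨ solve 3 (λ o p x → o :* p :* x := p :* (o :* x))
              ≈-refl (∏ (binomial ε i r) M) (binomial ε i r M) (∏ (binomial ε j r) N) ⟩
      binomial ε i r M ⊛ (∏ (binomial ε i r) M ⊛ ∏ (binomial ε j r) N)
        ≈⟨ *-congˡ (finiteTripleProduct M N) ⟩
      binomial ε i r M ⊛ antidiag H₂ (M + N)
        ≈⟨ binomial-⊛ i M (antidiag H₂ (M + N)) ⟩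
      mono ε (i + r * M) ⊛ antidiag H₂ (M + N) ⊕ antidiag H₂ (M + N)
        ≈⟨ +-congʳ (≈-trans (⊛-antidiag (mono ε (i + r * M)) H₂ (M + N)) (antidiag-cong (M + N) swap)) ⟩
      antidiag H₁ (M + N) ⊕ antidiag H₂ (M + N)
        ≈⟨ antidiag-pascal (λ m k → gauss m k ⊛ term (k ⊖ N)) H₁ H₂
             (λ k → *-congʳ (≈-sym (≈-trans (*-identityʳ (Q 0)) Q0≈1)))
             (λ m → *-congʳ (≈-sym (gauss-m-0 m)))
             (λ m k → ≈-trans (*-congʳ (gauss-pascal m k)) (distribʳ _ (Q (suc m) ⊛ gauss (suc m) k) (gauss m (suc k)))) (M + N) ⟨
      antidiag (λ m k → gauss m k ⊛ term (k ⊖ N)) (suc (M + N)) ∎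
      where
      H₁ H₂ : ℕ → ℕ → Series
      H₁ m k = Q m ⊛ gauss m k ⊛ term (suc k ⊖ N)
      H₂ m k = gauss m k ⊛ term (k ⊖ N)
      swap : ∀ m k → m + k ≡ M + N → mono ε (i + r * M) ⊛ H₂ m k ≈ H₁ m k
      swap m k m+k≡M+N = begin
        mono ε (i + r * M) ⊛ (gauss m k ⊛ term (k ⊖ N))
          ≈⟨ solve 3 (λ a g t → a :* (g :* t) := g :* (a :* t))
                ≈-refl (mono ε (i + r * M)) (gauss m k) (term (k ⊖ N)) ⟩
        gauss m k ⊛ (mono ε (i + r * M) ⊛ term (k ⊖ N))
          ≈⟨ *-congˡ (term-suc {m} {k} {M} {N} m+k≡M+N) ⟩
        gauss m k ⊛ (Q m ⊛ term (suc k ⊖ N))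
          ≈⟨ solve 3 (λ a g t → g :* (a :* t) := a :* g :* t) ≈-refl (Q m) (gauss m k) (term (suc k ⊖ N)) ⟩
        H₁ m k ∎

-- Infinite products

-- The diagonal of the partial products; it is their limit when u k ≡ 1 mod q^(k+1).
∏∞ : (ℕ → Series) → Series
∏∞ u n = ∏ u n n

TendsTo1 : (ℕ → Series) → Set
TendsTo1 u = ∀ k → u k ≈[ k ] 1#

∏∞≈∏ : ∀ {u K N} → TendsTo1 u → K ≤ N → ∏∞ u ≈[ K ] ∏ u N
∏∞≈∏ {u} u→1 K≤N = mod λ n≤K → go (ℕ.≤⇒≤′ (ℕ.≤-trans n≤K K≤N))
  where
  go : ∀ {n N} → n ≤′ N → ∏ u n n ≡ ∏ u N n
  go ≤′-refl = refl
  go {n} {suc N} (≤′-step n≤N) = trans (go n≤N) (sym (coeff step (ℕ.≤′⇒≤ n≤N)))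
    where
    open Mod N
    step : ∏ u N ⊛ u N ≈ ∏ u N
    step = ≈-trans (*-congˡ (u→1 N)) (*-identityʳ (∏ u N))

∏∞-cong : ∀ {u v K} → (∀ {K} k → u k ≈[ K ] v k) → ∏∞ u ≈[ K ] ∏∞ v
∏∞-cong u≈v = mod λ {n} _ → coeff (∏-cong n u≈v) ℕ.≤-refl

∏-⊛ : ∀ {K} u v n → ∏ u n ⊛ ∏ v n ≈[ K ] ∏ (λ k → u k ⊛ v k) n
∏-⊛ {K} u v zero    = *-identityˡ 1#
  where open Mod K
∏-⊛ {K} u v (suc n) = ≈-trans
  (solve 4 (λ a b c d → a :* b :* (c :* d) := a :* c :* (b :* d)) ≈-refl (∏ u n) (u n) (∏ v n) (v n))
  (*-congʳ (∏-⊛ u v n))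
  where open Mod K

TendsTo1-⊛ : ∀ {u v} → TendsTo1 u → TendsTo1 v → TendsTo1 (λ k → u k ⊛ v k)
TendsTo1-⊛ u→1 v→1 k = ≈-trans (*-cong (u→1 k) (v→1 k)) (*-identityˡ 1#)
  where open Mod k

∏∞-⊛ : ∀ {u v K} → TendsTo1 u → TendsTo1 v → ∏∞ u ⊛ ∏∞ v ≈[ K ] ∏∞ (λ k → u k ⊛ v k)
∏∞-⊛ {u} {v} {K} u→1 v→1 = begin
  ∏∞ u ⊛ ∏∞ v           ≈⟨ *-cong (∏∞≈∏ u→1 ℕ.≤-refl) (∏∞≈∏ v→1 ℕ.≤-refl) ⟩
  ∏ u K ⊛ ∏ v K         ≈⟨ ∏-⊛ u v K ⟩
  ∏ (λ k → u k ⊛ v k) K ≈⟨ ∏∞≈∏ (TendsTo1-⊛ u→1 v→1) ℕ.≤-refl ⟨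
  ∏∞ (λ k → u k ⊛ v k)  ∎
  where open Mod K

∏∞-1 : ∀ {K} → ∏∞ (λ _ → 1#) ≈[ K ] 1#
∏∞-1 = mod λ {n} _ → coeff (go n n) ℕ.≤-refl
  where
  go : ∀ K n → ∏ (λ _ → 1#) n ≈[ K ] 1#
  go K zero    = Mod.≈-refl K
  go K (suc n) = Mod.≈-trans K (Mod.*-identityʳ K _) (go K n)

∏-split₂ : ∀ {K} u n → ∏ u (2 * n) ≈[ K ] ∏ (λ k → u (2 * k)) n ⊛ ∏ (λ k → u (1 + 2 * k)) n
∏-split₂ {K} u zero    = Mod.≈-sym K (Mod.*-identityˡ K 1#)
∏-split₂ {K} u (suc n) = begin
  ∏ u (2 * suc n)                             ≡⟨ cong (∏ u) (ℕ.*-suc 2 n) ⟩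
  ∏ u (2 * n) ⊛ u (2 * n) ⊛ u (1 + 2 * n)      ≈⟨ *-congʳ (*-congʳ (∏-split₂ u n)) ⟩
  E ⊛ O ⊛ u (2 * n) ⊛ u (1 + 2 * n)
    ≈⟨ solve 4 (λ a b c d → a :* b :* c :* d := a :* c :* (b :* d)) ≈-refl E O (u (2 * n)) (u (1 + 2 * n)) ⟩
  E ⊛ u (2 * n) ⊛ (O ⊛ u (1 + 2 * n))         ∎
  where
  open Mod K
  E O : Series
  E = ∏ (λ k → u (2 * k)) n
  O = ∏ (λ k → u (1 + 2 * k)) n

∏-split₃ : ∀ {K} u n → ∏ u (3 * n) ≈[ K ]
  ∏ (λ k → u (3 * k)) n ⊛ ∏ (λ k → u (1 + 3 * k)) n ⊛ ∏ (λ k → u (2 + 3 * k)) n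
∏-split₃ {K} u zero    = Mod.≈-sym K (Mod.≈-trans K (Mod.*-identityʳ K _) (Mod.*-identityˡ K 1#))
∏-split₃ {K} u (suc n) = begin
  ∏ u (3 * suc n)                             ≡⟨ cong (∏ u) (ℕ.*-suc 3 n) ⟩
  ∏ u (3 * n) ⊛ a ⊛ b ⊛ c                     ≈⟨ *-congʳ (*-congʳ (*-congʳ (∏-split₃ u n))) ⟩
  P₀ ⊛ P₁ ⊛ P₂ ⊛ a ⊛ b ⊛ c
    ≈⟨ solve 6 (λ P₀ P₁ P₂ a b c → P₀ :* P₁ :* P₂ :* a :* b :* c := P₀ :* a :* (P₁ :* b) :* (P₂ :* c))
          ≈-refl P₀ P₁ P₂ a b c ⟩
  P₀ ⊛ a ⊛ (P₁ ⊛ b) ⊛ (P₂ ⊛ c)                   ∎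
  where
  open Mod K
  a b c P₀ P₁ P₂ : Series
  a = u (3 * n)
  b = u (1 + 3 * n)
  c = u (2 + 3 * n)
  P₀ = ∏ (λ k → u (3 * k)) n
  P₁ = ∏ (λ k → u (1 + 3 * k)) n
  P₂ = ∏ (λ k → u (2 + 3 * k)) n

shift-< : ∀ {e n} A → n ℕ.< e → shift e A n ≡ 0ℤ
shift-< {suc e} {zero}  A _         = refl
shift-< {suc e} {suc n} A (s≤s n<e) = shift-< A n<e

shift-+ : ∀ e A n → shift e A (e + n) ≡ A n
shift-+ zero    A n = refl
shift-+ (suc e) A n = shift-+ e A n

mono-below : ∀ {K} c e → K ℕ.< e → mono c e ≈[ K ] 0#
mono-below {K} c e K<e = ≈-trans (≈-sym (*-identityʳ (mono c e))) (mod λ {n} n≤K →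
  trans (mono-⊛ c e 1# n) (trans (cong (c ℤ.*_) (shift-< 1# (ℕ.≤-<-trans n≤K K<e))) (ℤ.*-zeroʳ c)))
  where open Mod K

1⊕mono≈1 : ∀ {K} c e → K ℕ.< e → 1# ⊕ mono c e ≈[ K ] 1#
1⊕mono≈1 {K} c e K<e = ≈-trans (+-congˡ (mono-below c e K<e)) (+-identityʳ 1#)
  where open Mod K

k<i+r*k : ∀ i r .{{_ : NonZero i}} .{{_ : NonZero r}} k → k ℕ.< i + r * k
k<i+r*k (suc i) r k = s≤s (ℕ.≤-trans (ℕ.m≤n*m k r) (ℕ.m≤n+m (r * k) i))

binomial→1 : ∀ ε i r .{{_ : NonZero i}} .{{_ : NonZero r}} → TendsTo1 (binomial ε i r)
binomial→1 ε i r k = 1⊕mono≈1 ε (i + r * k) (k<i+r*k i r k)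

-- ∏ (1 + ε q^(i + r k)) over k ≥ 0
binomials : ℤ → ℕ → ℕ → Series
binomials ε i r = ∏∞ (binomial ε i r)

euler : ℕ → Series
euler r = binomials -1ℤ r r

module _ {K : ℕ} (ε : ℤ) (i r : ℕ) .{{_ : NonZero i}} .{{_ : NonZero r}} where
  open Mod K

  binomials-split₂ : .{{_ : NonZero (i + r)}} .{{_ : NonZero (2 * r)}} →
    binomials ε i r ≈ binomials ε i (2 * r) ⊛ binomials ε (i + r) (2 * r)
  binomials-split₂ = begin
    binomials ε i r ≈⟨ ∏∞≈∏ (binomial→1 ε i r) (ℕ.m≤n*m K 2) ⟩
    ∏ (binomial ε i r) (2 * K) ≈⟨ ∏-split₂ (binomial ε i r) K ⟩
    ∏ (λ k → binomial ε i r (2 * k)) K ⊛ ∏ (λ k → binomial ε i r (1 + 2 * k)) K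
      ≈⟨ *-cong (∏-cong K λ k → +-congˡ (mono-cong refl (even i r k))) (∏-cong K λ k → +-congˡ
            (mono-cong refl (odd i r k))) ⟩
    ∏ (binomial ε i (2 * r)) K ⊛ ∏ (binomial ε (i + r) (2 * r)) K
      ≈⟨ *-cong (∏∞≈∏ (binomial→1 ε i (2 * r)) ℕ.≤-refl) (∏∞≈∏ (binomial→1 ε (i + r) (2 * r)) ℕ.≤-refl) ⟨
    binomials ε i (2 * r) ⊛ binomials ε (i + r) (2 * r) ∎
    where
    even : ∀ i r k → i + r * (2 * k) ≡ i + 2 * r * k
    even = ℕ-solve-∀
    odd : ∀ i r k → i + r * (1 + 2 * k) ≡ i + r + 2 * r * k
    odd = ℕ-solve-∀

  binomials-split₃ : .{{_ : NonZero (i + r)}} .{{_ : NonZero (i + 2 * r)}} .{{_ : NonZero (3 * r)}} →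
    binomials ε i r ≈ binomials ε i (3 * r) ⊛ binomials ε (i + r) (3 * r) ⊛ binomials ε (i + 2 * r) (3 * r)
  binomials-split₃ = begin
    binomials ε i r ≈⟨ ∏∞≈∏ (binomial→1 ε i r) (ℕ.m≤n*m K 3) ⟩
    ∏ (binomial ε i r) (3 * K) ≈⟨ ∏-split₃ (binomial ε i r) K ⟩
    ∏ (λ k → binomial ε i r (3 * k)) K ⊛ ∏ (λ k → binomial ε i r (1 + 3 * k)) K ⊛ ∏ (λ k → binomial ε i r (2 + 3 * k)) K
      ≈⟨ *-cong (*-cong (∏-cong K λ k → +-congˡ (mono-cong refl (residue₀ i r k))) (∏-cong K λ k → +-congˡ
            (mono-cong refl (residue₁ i r k)))) (∏-cong K λ k → +-congˡ (mono-cong refl (residue₂ i r k))) ⟩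
    ∏ (binomial ε i (3 * r)) K ⊛ ∏ (binomial ε (i + r) (3 * r)) K ⊛ ∏ (binomial ε (i + 2 * r) (3 * r)) K
      ≈⟨ *-cong (*-cong (∏∞≈∏ (binomial→1 ε i (3 * r)) ℕ.≤-refl)
            (∏∞≈∏ (binomial→1 ε (i + r) (3 * r)) ℕ.≤-refl)) (∏∞≈∏ (binomial→1 ε (i + 2 * r) (3 * r)) ℕ.≤-refl) ⟨
    binomials ε i (3 * r) ⊛ binomials ε (i + r) (3 * r) ⊛ binomials ε (i + 2 * r) (3 * r) ∎
    where
    residue₀ : ∀ i r k → i + r * (3 * k) ≡ i + 3 * r * k
    residue₀ = ℕ-solve-∀
    residue₁ : ∀ i r k → i + r * (1 + 3 * k) ≡ i + r + 3 * r * k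
    residue₁ = ℕ-solve-∀
    residue₂ : ∀ i r k → i + r * (2 + 3 * k) ≡ i + 2 * r + 3 * r * k
    residue₂ = ℕ-solve-∀

module _ {K : ℕ} (i r : ℕ) .{{_ : NonZero i}} .{{_ : NonZero r}} where
  open Mod K

  -- Factor by factor this is (1 + x)(1 - x) = 1 - x² with x = q^(i + r k).
  binomials-± : .{{_ : NonZero (2 * i)}} .{{_ : NonZero (2 * r)}} →
    binomials 1ℤ i r ⊛ binomials -1ℤ i r ≈ binomials -1ℤ (2 * i) (2 * r)
  binomials-± = ≈-trans (∏∞-⊛ (binomial→1 1ℤ i r) (binomial→1 -1ℤ i r)) (∏∞-cong λ {K} k → lemma K k)
    where
    lemma : ∀ K k → binomial 1ℤ i r k ⊛ binomial -1ℤ i r k ≈[ K ] binomial -1ℤ (2 * i) (2 * r) k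
    lemma K k = M.begin
      (1# ⊕ mono 1ℤ d) ⊛ (1# ⊕ mono -1ℤ d)
        M.≈⟨ M.solve 3 (λ o x y → (o M.:+ x) M.:* (o M.:+ y) M.:= o M.:* o M.:+ (o M.:* x M.:+ o M.:* y M.:+ x M.:* y)) M.≈-refl 1# (mono 1ℤ d) (mono -1ℤ d) ⟩
      1# ⊛ 1# ⊕ (1# ⊛ mono 1ℤ d ⊕ 1# ⊛ mono -1ℤ d ⊕ mono 1ℤ d ⊛ mono -1ℤ d)
        M.≈⟨ M.+-cong (M.*-identityˡ 1#) (M.+-cong (M.≈-trans (M.+-cong (M.*-identityˡ _) (M.*-identityˡ _))
              (M.≈-trans (mono-⊕-mono 1ℤ -1ℤ d) (mono-0 d))) (mono-*-mono 1ℤ d -1ℤ d)) ⟩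
      1# ⊕ (0# ⊕ mono -1ℤ (d + d))
        M.≈⟨ M.+-congˡ (M.≈-trans (M.+-identityˡ _) (mono-cong refl (double i r k))) ⟩
      binomial -1ℤ (2 * i) (2 * r) k M.∎
      where
      module M = Mod K
      d : ℕ
      d = i + r * k
      double : ∀ i r k → i + r * k + (i + r * k) ≡ 2 * i + 2 * r * k
      double = ℕ-solve-∀

-- Inverses of Euler products

-- 1 / (1 - q^d)
geometric : (d : ℕ) .{{_ : NonZero d}} → Series
geometric d n = 1# (n % d)

geometric-shift : ∀ d .{{_ : NonZero d}} n → geometric d n ≡ 1# n ℤ.+ shift d (geometric d) n
geometric-shift d n with n ℕ.<? d
... | yes n<d = trans (cong 1# (m<n⇒m%n≡m n<d)) (sym (trans (cong
      (λ x → 1# n ℤ.+ x) (shift-< (geometric d) n<d)) (ℤ.+-identityʳ (1# n))))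
... | no  n≮d = subst (λ n → geometric d n
      ≡ 1# n ℤ.+ shift d (geometric d) n) (ℕ.m+[n∸m]≡n (ℕ.≮⇒≥ n≮d)) (beyond (n ∸ d))
  where
  1#-beyond : ∀ d .{{_ : NonZero d}} m → 1# (d + m) ≡ 0ℤ
  1#-beyond (suc d) m = refl
  beyond : ∀ m → geometric d (d + m) ≡ 1# (d + m) ℤ.+ shift d (geometric d) (d + m)
  beyond m = begin
    1# ((d + m) % d)                            ≡⟨ cong (λ x → 1# (x % d)) (ℕ.+-comm d m) ⟩
    1# ((m + d) % d)                            ≡⟨ cong 1# ([m+n]%n≡m%n m d) ⟩
    geometric d m                               ≡⟨ shift-+ d (geometric d) m ⟨
    shift d (geometric d) (d + m)               ≡⟨ ℤ.+-identityˡ _ ⟨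
    0ℤ ℤ.+ shift d (geometric d) (d + m)
      ≡⟨ cong (ℤ._+ shift d (geometric d) (d + m)) (1#-beyond d m) ⟨
    1# (d + m) ℤ.+ shift d (geometric d) (d + m) ∎
    where open ≡-Reasoning

geometric-inverse : ∀ {K} d .{{_ : NonZero d}} → geometric d ⊛ (1# ⊕ mono -1ℤ d) ≈[ K ] 1#
geometric-inverse {K} d = ≈-trans (solve 3 (λ g o x → g :* (o :+ x) := o :* g :+ x :* g)
      ≈-refl (geometric d) 1# (mono -1ℤ d))
  (≈-trans (+-congʳ (*-identityˡ (geometric d))) (≗⇒≈ λ n → begin′
    (geometric d ⊕ mono -1ℤ d ⊛ geometric d) n                      ≡⟨ ⊕-coeff (geometric d) _ n ⟩
    geometric d n ℤ.+ (mono -1ℤ d ⊛ geometric d) n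
      ≡⟨ cong₂ ℤ._+_ (geometric-shift d n) (mono-⊛ -1ℤ d (geometric d) n) ⟩
    1# n ℤ.+ shift d (geometric d) n ℤ.+ -1ℤ ℤ.* shift d (geometric d) n
      ≡⟨ lemma (1# n) (shift d (geometric d) n) ⟩
    1# n ∎′))
  where
  open Mod K hiding (step-≡-⟩)
  open ≡-Reasoning using (step-≡-⟩) renaming (begin_ to begin′_; _∎ to _∎′)
  lemma : ∀ x y → x ℤ.+ y ℤ.+ -1ℤ ℤ.* y ≡ x
  lemma = solve-∀

geometric→1 : ∀ d .{{_ : NonZero d}} {K} → K ℕ.< d → geometric d ≈[ K ] 1#
geometric→1 d K<d = mod λ n≤K → cong 1# (m<n⇒m%n≡m (ℕ.≤-<-trans n≤K K<d))

module _ (r : ℕ) .{{_ : NonZero r}} where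

  instance
    r+r*k≢0 : ∀ {k} → NonZero (r + r * k)
    r+r*k≢0 {k} = >-nonZero (ℕ.≤-trans (s≤s z≤n) (k<i+r*k r r k))

  -- The series 1/f_r, generating partitions into multiples of r. An explicit product of geometric
  -- series shows the signs and the support of its coefficients factor by factor.
  partition : Series
  partition = ∏∞ (λ k → geometric (r + r * k))

  partition→1 : TendsTo1 (λ k → geometric (r + r * k))
  partition→1 k = geometric→1 (r + r * k) (k<i+r*k r r k)

  partition-⊛-euler : ∀ {K} → partition ⊛ euler r ≈[ K ] 1#
  partition-⊛-euler {K} = ≈-trans (∏∞-⊛ partition→1 (binomial→1 -1ℤ r r))
    (≈-trans (∏∞-cong λ k → geometric-inverse (r + r * k)) ∏∞-1)
    where open Mod K

f≈euler : ∀ {K} j .{{_ : NonZero j}} → f j ≈[ K ] euler j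
f≈euler j = mod λ {n} _ → coeff (go n n) ℕ.≤-refl
  where
  opaque
    unfolding _⊕_ _⊛_ mono
    go : ∀ K n → f-upto j n ≈[ K ] ∏ (binomial -1ℤ j j) n
    go K zero    = Mod.≈-refl K
    go K (suc n) = ⊛-cong (go K n) (≗⇒≈ λ m → cong (λ x → 1# m ℤ.+ x)
      (trans (cong (λ x → ℤ.- (q^ x) m) (ℕ.*-suc j n)) (sym (ℤ.-1*i≡-i _))))

-- Jacobi's triple product modulo q^(N+1)

module _ (ε : ℤ) (ε*ε≡1 : ε ℤ.* ε ≡ 1ℤ) (i j : ℕ) .{{_ : NonZero i}} .{{_ : NonZero j}} .{{_ : NonZero (i + j)}} where
  open TripleProduct ε ε*ε≡1 i j

  -- The product side of Jacobi's identity for f(ε q^i, ε q^j).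
  theta : Series
  theta = binomials ε i (i + j) ⊛ binomials ε j (i + j) ⊛ euler (i + j)

  -- In `gauss-∏` all three products agree with `euler r` to this order, so the coefficient behaves
  -- as E/E² = 1/E. The inserted factor `partition r ⊛ E` supplies the second E for the denominator
  -- and later cancels the E of the numerator.
  gauss-limit : ∀ {K m k} → K ≤ m → K ≤ k → Gaussian.gauss r m k ⊛ euler r ≈[ K ] 1#
  gauss-limit {K} {m} {k} K≤m K≤k = begin
    g ⊛ E ≈⟨ ≈-trans (*-congˡ (partition-⊛-euler r)) (*-identityʳ (g ⊛ E)) ⟨
    g ⊛ E ⊛ (partition r ⊛ E)
      ≈⟨ solve 3 (λ g e p → g :* e :* (p :* e) := g :* (e :* e) :* p) ≈-refl g E (partition r) ⟩
    g ⊛ (E ⊛ E) ⊛ partition r ≈⟨ *-congʳ (*-congˡ (*-cong (∏w≈E K≤m) (∏w≈E K≤k))) ⟨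
    g ⊛ (∏ w m ⊛ ∏ w k) ⊛ partition r ≈⟨ *-congʳ (gauss-∏ m k) ⟩
    ∏ w (m + k) ⊛ partition r ≈⟨ *-congʳ (∏w≈E (ℕ.≤-trans K≤m (ℕ.m≤m+n m k))) ⟩
    E ⊛ partition r ≈⟨ *-comm E (partition r) ⟩
    partition r ⊛ E ≈⟨ partition-⊛-euler r ⟩
    1# ∎
    where
    open Mod K
    open GaussianBinomial K r
    g E : Series
    g = gauss m k
    E = euler r
    ∏w≈E : ∀ {n} → K ≤ n → ∏ w n ≈ E
    ∏w≈E {n} K≤n = ≈-trans (∏-cong n λ k → +-congˡ (mono-cong refl (ℕ.*-suc r k))) (≈-sym
          (∏∞≈∏ (binomial→1 -1ℤ r r) K≤n))

  -- `gauss-limit` is accurate only up to min(m, k), which is too weak near the ends of the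
  -- antidiagonal. There the term itself carries at least q^|k-N|, and |k - N| + min(m, k) = N is
  -- just enough.
  term-⊛-gauss : ∀ {N m k} → m + k ≡ N + N →
    term (k ⊖ N) ⊛ (Gaussian.gauss r m k ⊛ euler r) ≈[ N ] term (k ⊖ N)
  term-⊛-gauss {N} {m} {k} m+k≡2N with ℕ.≤-total k N
  ... | inj₁ k≤N = ≈-trans (mono-⊛-cong (sgn (k ⊖ N)) (e (k ⊖ N)) N≤e+k (gauss-limit k≤m ℕ.≤-refl)) (*-identityʳ _)
    where
    open Mod N
    k≤m : k ≤ m
    k≤m = ℕ.≤-trans k≤N (ℕ.+-cancelʳ-≤ N N m (ℕ.≤-trans (ℕ.≤-reflexive (sym m+k≡2N)) (ℕ.+-monoʳ-≤ m k≤N)))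
    N≤e+k : N ≤ e (k ⊖ N) + k
    N≤e+k = ℕ.≤-trans (ℕ.≤-reflexive (sym (trans (cong (_+ k)
          (ℤ.∣⊖∣-≤ k≤N)) (ℕ.m∸n+n≡m k≤N)))) (ℕ.+-monoˡ-≤ k (∣n∣≤exponent i j (k ⊖ N)))
  ... | inj₂ N≤k = ≈-trans (mono-⊛-cong (sgn (k ⊖ N)) (e (k ⊖ N)) N≤e+m (gauss-limit ℕ.≤-refl m≤k)) (*-identityʳ _)
    where
    open Mod N
    m≤N : m ≤ N
    m≤N = ℕ.+-cancelʳ-≤ N m N (ℕ.≤-trans (ℕ.+-monoʳ-≤ m N≤k) (ℕ.≤-reflexive m+k≡2N))
    m≤k : m ≤ k
    m≤k = ℕ.≤-trans m≤N N≤k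
    k∸N+m≡N : k ∸ N + m ≡ N
    k∸N+m≡N = ℕ.+-cancelˡ-≡ N _ _ (trans (sym (ℕ.+-assoc N (k ∸ N) m)) (trans (cong (_+ m) (ℕ.m+[n∸m]≡n N≤k))
          (trans (ℕ.+-comm k m) m+k≡2N)))
    ∣k⊖N∣≡k∸N : ∣ k ⊖ N ∣ ≡ k ∸ N
    ∣k⊖N∣≡k∸N = cong ∣_∣ (ℤ.⊖-≥ N≤k)
    N≤e+m : N ≤ e (k ⊖ N) + m
    N≤e+m = ℕ.≤-trans (ℕ.≤-reflexive (sym (trans
          (cong (_+ m) ∣k⊖N∣≡k∸N) k∸N+m≡N))) (ℕ.+-monoˡ-≤ m (∣n∣≤exponent i j (k ⊖ N)))

  theta-sum : ∀ N → theta ≈[ N ] antidiag (λ _ k → term (k ⊖ N)) (N + N)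
  theta-sum N = begin
    theta
      ≈⟨ *-congʳ (*-cong (∏∞≈∏ (binomial→1 ε i r) ℕ.≤-refl) (∏∞≈∏ (binomial→1 ε j r) ℕ.≤-refl)) ⟩
    ∏ (binomial ε i r) N ⊛ ∏ (binomial ε j r) N ⊛ euler r ≈⟨ *-congʳ (finiteTripleProduct N N N) ⟩
    antidiag (λ m k → gauss m k ⊛ term (k ⊖ N)) (N + N) ⊛ euler r ≈⟨ *-comm _ (euler r) ⟩
    euler r ⊛ antidiag (λ m k → gauss m k ⊛ term (k ⊖ N)) (N + N)
      ≈⟨ ⊛-antidiag (euler r) _ (N + N) ⟩
    antidiag (λ m k → euler r ⊛ (gauss m k ⊛ term (k ⊖ N))) (N + N)
      ≈⟨ antidiag-cong (N + N) (λ m k m+k≡2N → ≈-trans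
           (solve 3 (λ e g t → e :* (g :* t) := t :* (g :* e)) ≈-refl (euler r) (gauss m k) (term (k ⊖ N)))
           (term-⊛-gauss m+k≡2N)) ⟩
    antidiag (λ _ k → term (k ⊖ N)) (N + N) ∎
    where
    open Mod N
    open GaussianBinomial N r

-- Dissection of a double theta series

∑ : {X : Set} → List X → (X → Series) → Series
∑ []       g = 0#
∑ (x ∷ xs) g = g x ⊕ ∑ xs g

module _ {X : Set} {K : ℕ} where
  open Mod K

  ∑-cong : ∀ {g h : X → Series} xs → (∀ x → g x ≈ h x) → ∑ xs g ≈ ∑ xs h
  ∑-cong []       g≈h = ≈-refl
  ∑-cong (x ∷ xs) g≈h = +-cong (g≈h x) (∑-cong xs g≈h)

  ∑-0 : ∀ {g : X → Series} xs → (∀ {x} → x ∈ xs → g x ≈ 0#) → ∑ xs g ≈ 0#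
  ∑-0 []       g≈0 = ≈-refl
  ∑-0 (x ∷ xs) g≈0 = ≈-trans (+-cong (g≈0 (here refl)) (∑-0 xs (g≈0 ∘ there))) (+-identityˡ 0#)

  ∑-++ : ∀ {g : X → Series} xs ys → ∑ (xs ++ ys) g ≈ ∑ xs g ⊕ ∑ ys g
  ∑-++ []       ys = ≈-sym (+-identityˡ _)
  ∑-++ (x ∷ xs) ys = ≈-trans (+-congˡ (∑-++ xs ys)) (≈-sym (+-assoc _ _ _))

  ∑-↭ : ∀ {g : X → Series} {xs ys} → xs ↭ ys → ∑ xs g ≈ ∑ ys g
  ∑-↭ ↭.refl          = ≈-refl
  ∑-↭ (↭.prep x xs↭ys) = +-congˡ (∑-↭ xs↭ys)
  ∑-↭ {g} (↭.swap x y xs↭ys) = ≈-trans (+-congˡ (+-congˡ (∑-↭ xs↭ys)))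
    (solve 3 (λ a b c → a :+ (b :+ c) := b :+ (a :+ c)) ≈-refl (g x) (g y) _)
  ∑-↭ (↭.trans p q)   = ≈-trans (∑-↭ p) (∑-↭ q)

  ⊛-∑ : ∀ A {g : X → Series} xs → A ⊛ ∑ xs g ≈ ∑ xs (λ x → A ⊛ g x)
  ⊛-∑ A     []       = zeroʳ A
  ⊛-∑ A {g} (x ∷ xs) = ≈-trans (distribˡ A (g x) _) (+-congˡ (⊛-∑ A xs))

  -- Each `x` of `xs` is moved to the front of `ys` by a permutation and removed; whatever is left
  -- of `ys` contributes nothing. Uniqueness ensures that a removed element is not wanted again.
  ∑-extend : ∀ {g : X → Series} {xs ys} → Unique xs → Unique ys → (∀ {x} → x ∈ xs → x ∈ ys) →
             (∀ {x} → x ∈ ys → x ∈ xs ⊎ g x ≈ 0#) → ∑ xs g ≈ ∑ ys g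
  ∑-extend {g} {[]} {ys} _ _ _ outside = ≈-sym (∑-0 ys vanish)
    where
    vanish : ∀ {x} → x ∈ ys → g x ≈ 0#
    vanish x∈ys with outside x∈ys
    ... | inj₂ gx≈0 = gx≈0
  ∑-extend {g} {x ∷ xs} {ys} (x∉xs ∷ xs!) ys! xs⊆ys outside
    with as , bs , refl ← ∈-∃++ (xs⊆ys (here refl))
    with ys↭x∷zs ← ↭-shift x as bs
    with x∉zs ∷ zs! ← ↭ₛ.Unique-resp-↭ (setoid X) (↭⇒↭ₛ ys↭x∷zs) ys! =
    ≈-trans (+-congˡ (∑-extend xs! zs! xs⊆zs outside′)) (≈-sym (∑-↭ ys↭x∷zs))
    where
    xs⊆zs : ∀ {y} → y ∈ xs → y ∈ as ++ bs
    xs⊆zs y∈xs with ∈-resp-↭ ys↭x∷zs (xs⊆ys (there y∈xs))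
    ... | here refl  = ⊥-elim (All.lookup x∉xs y∈xs refl)
    ... | there y∈zs = y∈zs
    outside′ : ∀ {y} → y ∈ as ++ bs → y ∈ xs ⊎ g y ≈ 0#
    outside′ y∈zs with outside (∈-resp-↭ (↭-sym ys↭x∷zs) (there y∈zs))
    ... | inj₁ (here refl)  = ⊥-elim (All.lookup x∉zs y∈zs refl)
    ... | inj₁ (there y∈xs) = inj₁ y∈xs
    ... | inj₂ gy≈0         = inj₂ gy≈0

∑-map : ∀ {X Y : Set} (φ : X → Y) (g : Y → Series) xs → ∑ (map φ xs) g ≡ ∑ xs (g ∘ φ)
∑-map φ g []       = refl
∑-map φ g (x ∷ xs) = cong (g (φ x) ⊕_) (∑-map φ g xs)

∑-⊛-∑ : ∀ {X Y : Set} {K} (g : X → Series) (h : Y → Series) xs ys →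
  ∑ xs g ⊛ ∑ ys h ≈[ K ] ∑ (cartesianProduct xs ys) (λ (x , y) → g x ⊛ h y)
∑-⊛-∑ {K = K} g h []       ys = Mod.zeroˡ K _
∑-⊛-∑ {K = K} g h (x ∷ xs) ys = begin
  (g x ⊕ ∑ xs g) ⊛ ∑ ys h                 ≈⟨ distribʳ _ (g x) (∑ xs g) ⟩
  g x ⊛ ∑ ys h ⊕ ∑ xs g ⊛ ∑ ys h          ≈⟨ +-cong (⊛-∑ (g x) ys) (∑-⊛-∑ g h xs ys) ⟩
  ∑ ys (λ y → g x ⊛ h y) ⊕ ∑ (cartesianProduct xs ys) gh
    ≡⟨ cong (_⊕ ∑ (cartesianProduct xs ys) gh) (∑-map (x ,_) gh ys) ⟨
  ∑ (map (x ,_) ys) gh ⊕ ∑ (cartesianProduct xs ys) gh   ≈⟨ ∑-++ (map (x ,_) ys) _ ⟨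
  ∑ (cartesianProduct (x ∷ xs) ys) gh     ∎
  where
  open Mod K
  gh : _ × _ → Series
  gh (x , y) = g x ⊛ h y

-- The integers from -N to N, listed in the order in which `theta-sum` produces them.
window : ℕ → List ℤ
window N = applyUpTo (_⊖ N) (suc (N + N))

antidiag≈∑ : ∀ {K} {X : Set} (t : X → Series) φ L →
  antidiag (λ _ k → t (φ k)) L ≈[ K ] ∑ (applyUpTo φ (suc L)) t
antidiag≈∑ {K} t φ zero    = Mod.≈-sym K (Mod.+-identityʳ K _)
antidiag≈∑ {K} t φ (suc L) = Mod.+-congˡ K (antidiag≈∑ t (φ ∘ suc) L)

∈-window : ∀ {N n} → ∣ n ∣ ≤ N → n ∈ window N
∈-window {N} {+ p}      p≤N = subst (_∈ window N)
  (trans (ℤ.⊖-≥ (ℕ.m≤m+n N p)) (cong +_ (ℕ.m+n∸m≡n N p)))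
  (∈-applyUpTo⁺ (_⊖ N) (s≤s (ℕ.+-monoʳ-≤ N p≤N)))
∈-window {N} {n@(-[1+ p ])} p<N = subst (_∈ window N)
  (trans (ℤ.⊖-≤ (ℕ.m∸n≤m N (suc p))) (cong (λ m → ℤ.- + m) (ℕ.m∸[m∸n]≡n p<N)))
  (∈-applyUpTo⁺ (_⊖ N) (s≤s (ℕ.≤-trans (ℕ.m∸n≤m N (suc p)) (ℕ.m≤m+n N N))))

window-unique : ∀ N → Unique (window N)
window-unique N = Unique.applyUpTo⁺₁ (_⊖ N) _ λ {i} {j} i<j _ i⊖N≡j⊖N →
  ℕ.<⇒≢ i<j (ℤ.+-injective (ℤ-+-cancelʳ (ℤ.- + N) (+ i) (+ j) (trans (ℤ.m-n≡m⊖n i N) (trans i⊖N≡j⊖N (sym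
        (ℤ.m-n≡m⊖n j N))))))

window-⁻ : ∀ {N n} → n ∈ window N → ∣ n ∣ ≤ N
window-⁻ {N} n∈ with k , k<1+2N , refl ← ∈-applyUpTo⁻ (_⊖ N) n∈ with ℕ.≤-total k N
... | inj₁ k≤N = ℕ.≤-trans (ℕ.≤-reflexive (ℤ.∣⊖∣-≤ k≤N)) (ℕ.m∸n≤m N k)
... | inj₂ N≤k = ℕ.≤-trans (ℕ.≤-reflexive (cong ∣_∣ (ℤ.⊖-≥ N≤k))) (ℕ.m≤n+o⇒m∸n≤o k N (ℕ.≤-pred k<1+2N))

box : ℕ → List (ℤ × ℤ)
box N = cartesianProduct (window N) (window N)

-- These parametrise the pairs (m, n) with m + n even and odd: s is half of m + n or of m + n - 1,
-- and t = s - n.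
even odd : ℤ × ℤ → ℤ × ℤ
even (s , t) = s ℤ.+ t , s ℤ.- t
odd  (s , t) = 1ℤ ℤ.+ (s ℤ.+ t) , s ℤ.- t

halve : ∀ n → ∃ λ s → n ≡ s ℤ.+ s ⊎ n ≡ 1ℤ ℤ.+ (s ℤ.+ s)
halve n = n /ℕ 2 , go (n %ℕ 2) (n%ℕd<d n 2) (a≡a%ℕn+[a/ℕn]*n n 2)
  where
  lemma₀ : ∀ s → 0ℤ ℤ.+ s ℤ.* + 2 ≡ s ℤ.+ s
  lemma₀ = solve-∀
  lemma₁ : ∀ s → 1ℤ ℤ.+ s ℤ.* + 2 ≡ 1ℤ ℤ.+ (s ℤ.+ s)
  lemma₁ = solve-∀
  go : ∀ r → r ℕ.< 2 → n ≡ + r ℤ.+ (n /ℕ 2) ℤ.* + 2 →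
    n ≡ (n /ℕ 2) ℤ.+ (n /ℕ 2) ⊎ n ≡ 1ℤ ℤ.+ ((n /ℕ 2) ℤ.+ (n /ℕ 2))
  go 0 _ eq = inj₁ (trans eq (lemma₀ (n /ℕ 2)))
  go 1 _ eq = inj₂ (trans eq (lemma₁ (n /ℕ 2)))
  go (suc (suc r)) (s≤s (s≤s ())) eq

double : ∀ s → s ℤ.+ s ≡ + 2 ℤ.* s
double = solve-∀

double-injective : ∀ {s t} → s ℤ.+ s ≡ t ℤ.+ t → s ≡ t
double-injective {s} {t} eq = ℤ.*-cancelˡ-≡ (+ 2) s t (trans (sym (double s)) (trans eq (double t)))

∣s∣≤∣s+s∣ : ∀ s → ∣ s ∣ ≤ ∣ s ℤ.+ s ∣
∣s∣≤∣s+s∣ s = ℕ.≤-trans (ℕ.m≤n*m ∣ s ∣ 2) (ℕ.≤-reflexive (trans (sym (ℤ.abs-* (+ 2) s)) (cong ∣_∣ (sym (double s)))))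

double≢1+double : ∀ s t → s ℤ.+ s ≢ 1ℤ ℤ.+ (t ℤ.+ t)
double≢1+double s t eq = absurd ∣ s ℤ.- t ∣ (trans (sym (ℤ.abs-* (+ 2) (s ℤ.- t))) (cong ∣_∣ eq′))
  where
  lemma₁ : ∀ s t → + 2 ℤ.* (s ℤ.- t) ≡ (s ℤ.+ s) ℤ.- (t ℤ.+ t)
  lemma₁ = solve-∀
  lemma₂ : ∀ t → 1ℤ ℤ.+ (t ℤ.+ t) ℤ.- (t ℤ.+ t) ≡ 1ℤ
  lemma₂ = solve-∀
  eq′ : + 2 ℤ.* (s ℤ.- t) ≡ 1ℤ
  eq′ = trans (lemma₁ s t) (trans (cong (λ x → x ℤ.- (t ℤ.+ t)) eq) (lemma₂ t))
  absurd : ∀ m → 2 * m ≢ 1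
  absurd (suc m) eq with () ← trans (sym (ℕ.+-suc m (m + 0))) (ℕ.suc-injective eq)

sum+difference : ∀ s t → (s ℤ.+ t) ℤ.+ (s ℤ.- t) ≡ s ℤ.+ s
sum+difference = solve-∀

even-injective : ∀ {x y} → even x ≡ even y → x ≡ y
even-injective {s , t} {s′ , t′} eq with double-injective {s} {s′} (trans (sym (sum+difference s t)) (trans
      (cong₂ ℤ._+_ (cong proj₁ eq) (cong proj₂ eq)) (sum+difference s′ t′)))
... | refl = cong (s ,_) (ℤ-+-cancelˡ s t t′ (cong proj₁ eq))

odd-injective : ∀ {x y} → odd x ≡ odd y → x ≡ y
odd-injective eq = even-injective (cong₂ _,_ (ℤ-+-cancelˡ 1ℤ _ _ (cong proj₁ eq)) (cong proj₂ eq))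

even≢odd : ∀ x y → even x ≢ odd y
even≢odd (s , t) (s′ , t′) eq = double≢1+double s s′ (trans (sym (sum+difference s t))
  (trans (cong₂ ℤ._+_ (cong proj₁ eq) (cong proj₂ eq)) (trans (ℤ.+-assoc 1ℤ (s′ ℤ.+ t′) (s′ ℤ.- t′)) (cong
        (λ x → 1ℤ ℤ.+ x) (sum+difference s′ t′)))))

parityBox : ℕ → List (ℤ × ℤ)
parityBox N = map even (box N) ++ map odd (box N)

parityBox-unique : ∀ N → Unique (parityBox N)
parityBox-unique N = Unique.++⁺ (Unique.map⁺ even-injective box!) (Unique.map⁺ odd-injective box!) disjoint
  where
  box! : Unique (box N)
  box! = Unique.cartesianProduct⁺ (window-unique N) (window-unique N)
  disjoint : ∀ {x} → (x ∈ map even (box N)) × (x ∈ map odd (box N)) → ⊥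
  disjoint (x∈even , x∈odd) with y , _ , refl ← ∈-map⁻ even {xs = box N} x∈even
        with z , _ , eq ← ∈-map⁻ odd {xs = box N} x∈odd = even≢odd y z eq

-- For |m|, |n| at most K, the index s satisfies |s| ≤ |2s| ≤ 2K + 1, and t is m - s or m - s - 1,
-- hence |t| ≤ K + (2K + 1) + 1. The bound is generous, but any covering box will do.
parityBox-radius : ℕ → ℕ
parityBox-radius K = K + suc (K + K) + 1

box⊆parityBox : ∀ {K x} → x ∈ box K → x ∈ parityBox (parityBox-radius K)
box⊆parityBox {K} {m , n} mn∈box with ∈-cartesianProduct⁻ (window K) (window K) mn∈box
... | m∈ , n∈ = go (halve (m ℤ.+ n))
  where
  N : ℕ
  N = parityBox-radius K
  ∣m∣≤K : ∣ m ∣ ≤ K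
  ∣m∣≤K = window-⁻ {K} m∈
  ∣m+n∣≤2K : ∣ m ℤ.+ n ∣ ≤ K + K
  ∣m+n∣≤2K = ℕ.≤-trans (ℤ.∣i+j∣≤∣i∣+∣j∣ m n) (ℕ.+-mono-≤ ∣m∣≤K (window-⁻ {K} n∈))
  ∣m-s∣≤ : ∀ s → ∣ s ∣ ≤ suc (K + K) → ∣ m ℤ.- s ∣ ≤ K + suc (K + K)
  ∣m-s∣≤ s ∣s∣≤ = ℕ.≤-trans (ℤ.∣i-j∣≤∣i∣+∣j∣ m s) (ℕ.+-mono-≤ ∣m∣≤K ∣s∣≤)
  s∈window : ∀ s → ∣ s ∣ ≤ suc (K + K) → s ∈ window N
  s∈window s ∣s∣≤ = ∈-window (ℕ.≤-trans ∣s∣≤ (ℕ.≤-trans (ℕ.m≤n+m _ K) (ℕ.m≤m+n _ 1)))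
  go : (∃ λ s → m ℤ.+ n ≡ s ℤ.+ s ⊎ m ℤ.+ n ≡ 1ℤ ℤ.+ (s ℤ.+ s)) → (m , n) ∈ parityBox N
  go (s , inj₁ eq) = subst (_∈ parityBox N) (cong₂ _,_ (lemma₁ s m) (trans (lemma₂ s m) (trans (cong (ℤ._- m)
        (sym eq)) (lemma₃ m n))))
    (∈-++⁺ˡ (∈-map⁺ even (∈-cartesianProduct⁺ (s∈window s ∣s∣≤)
      (∈-window (ℕ.≤-trans (∣m-s∣≤ s ∣s∣≤) (ℕ.m≤m+n _ 1))))))
    where
    lemma₁ : ∀ s m → s ℤ.+ (m ℤ.- s) ≡ m
    lemma₁ = solve-∀
    lemma₂ : ∀ s m → s ℤ.- (m ℤ.- s) ≡ (s ℤ.+ s) ℤ.- m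
    lemma₂ = solve-∀
    lemma₃ : ∀ m n → (m ℤ.+ n) ℤ.- m ≡ n
    lemma₃ = solve-∀
    ∣s∣≤ : ∣ s ∣ ≤ suc (K + K)
    ∣s∣≤ = ℕ.m≤n⇒m≤1+n (ℕ.≤-trans (∣s∣≤∣s+s∣ s) (ℕ.≤-trans (ℕ.≤-reflexive (cong ∣_∣ (sym eq))) ∣m+n∣≤2K))
  go (s , inj₂ eq) = subst (_∈ parityBox N) (cong₂ _,_ (lemma₁ s m) (trans (lemma₂ s m) (trans (cong (ℤ._- m)
        (sym eq)) (lemma₃ m n))))
    (∈-++⁺ʳ (map even (box N)) (∈-map⁺ odd (∈-cartesianProduct⁺ (s∈window s ∣s∣≤)
      (∈-window (ℕ.≤-trans (ℤ.∣i-j∣≤∣i∣+∣j∣ (m ℤ.- s) 1ℤ) (ℕ.+-monoˡ-≤ 1 (∣m-s∣≤ s ∣s∣≤)))))))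
    where
    lemma₁ : ∀ s m → 1ℤ ℤ.+ (s ℤ.+ (m ℤ.- s ℤ.- 1ℤ)) ≡ m
    lemma₁ = solve-∀
    lemma₂ : ∀ s m → s ℤ.- (m ℤ.- s ℤ.- 1ℤ) ≡ 1ℤ ℤ.+ (s ℤ.+ s) ℤ.- m
    lemma₂ = solve-∀
    lemma₃ : ∀ m n → (m ℤ.+ n) ℤ.- m ≡ n
    lemma₃ = solve-∀
    lemma₄ : ∀ s → s ℤ.+ s ≡ 1ℤ ℤ.+ (s ℤ.+ s) ℤ.- 1ℤ
    lemma₄ = solve-∀
    ∣s∣≤ : ∣ s ∣ ≤ suc (K + K)
    ∣s∣≤ = ℕ.≤-trans (∣s∣≤∣s+s∣ s) (ℕ.≤-trans (ℕ.≤-reflexive (cong ∣_∣ (trans (lemma₄ s) (cong (ℤ._- 1ℤ) (sym eq)))))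
      (ℕ.≤-trans (ℤ.∣i-j∣≤∣i∣+∣j∣ (m ℤ.+ n) 1ℤ) (ℕ.≤-trans (ℕ.+-monoˡ-≤ 1 ∣m+n∣≤2K)
            (ℕ.≤-reflexive (ℕ.+-comm (K + K) 1)))))

-- The rotated boxes cover `box K` without repetition, and any further pair they reach lies outside
-- `box K`, where `g` vanishes.
∑-box≈∑-parityBox : ∀ {K} (g : ℤ × ℤ → Series) →
  (∀ m n → K ℕ.< ∣ m ∣ ⊎ K ℕ.< ∣ n ∣ → g (m , n) ≈[ K ] 0#) →
  ∑ (box K) g ≈[ K ] ∑ (box (parityBox-radius K)) (g ∘ even) ⊕ ∑ (box (parityBox-radius K)) (g ∘ odd)
∑-box≈∑-parityBox {K} g g≈0 = begin
  ∑ (box K) g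
    ≈⟨ ∑-extend (Unique.cartesianProduct⁺ (window-unique K) (window-unique K)) (parityBox-unique N) (box⊆parityBox {K}) outside ⟩
  ∑ (parityBox N) g ≈⟨ ∑-++ (map even (box N)) (map odd (box N)) ⟩
  ∑ (map even (box N)) g ⊕ ∑ (map odd (box N)) g
    ≡⟨ cong₂ _⊕_ (∑-map even g (box N)) (∑-map odd g (box N)) ⟩
  ∑ (box N) (g ∘ even) ⊕ ∑ (box N) (g ∘ odd) ∎
  where
  open Mod K
  N : ℕ
  N = parityBox-radius K
  outside : ∀ {x} → x ∈ parityBox N → x ∈ box K ⊎ g x ≈ 0#
  outside {m , n} _ with ∣ m ∣ ℕ.≤? K | ∣ n ∣ ℕ.≤? K
  ... | yes m≤K | yes n≤K = inj₁ (∈-cartesianProduct⁺ (∈-window m≤K) (∈-window n≤K))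
  ... | no  m≰K | _       = inj₂ (g≈0 m n (inj₁ (ℕ.≰⇒> m≰K)))
  ... | yes _   | no  n≰K = inj₂ (g≈0 m n (inj₂ (ℕ.≰⇒> n≰K)))

θ⁺ θ⁻ : (i j : ℕ) .{{_ : NonZero i}} .{{_ : NonZero j}} .{{_ : NonZero (i + j)}} → Series
θ⁺ i j = theta 1ℤ refl i j
θ⁻ i j = theta -1ℤ refl i j

term⁺ term⁻ : ℕ → ℕ → ℤ → Series
term⁺ = TripleProduct.term 1ℤ refl
term⁻ = TripleProduct.term -1ℤ refl

theta≈∑ : ∀ {K N} ε (ε*ε≡1 : ε ℤ.* ε ≡ 1ℤ) i j .{{_ : NonZero i}} .{{_ : NonZero j}} .{{_ : NonZero (i + j)}} → K ≤ N →
  theta ε ε*ε≡1 i j ≈[ K ] ∑ (window N) (TripleProduct.term ε ε*ε≡1 i j)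
theta≈∑ {K} {N} ε ε*ε≡1 i j K≤N = Mod.≈-trans K (≈-weaken K≤N (theta-sum ε ε*ε≡1 i j N)) (antidiag≈∑ _ (_⊖ N) (N + N))

1^n≡1 : ∀ n → 1ℤ ℤ.^ n ≡ 1ℤ
1^n≡1 zero    = refl
1^n≡1 (suc n) = cong (1ℤ ℤ.*_) (1^n≡1 n)

sgn⁻ : ℤ → ℤ
sgn⁻ = Sign.sgn -1ℤ refl

2*-injective : ∀ {m n} → + 2 ℤ.* + m ≡ + 2 ℤ.* + n → m ≡ n
2*-injective {m} {n} eq = ℤ.+-injective (ℤ.*-cancelˡ-≡ (+ 2) (+ m) (+ n) eq)

2*sum : ∀ i j i′ j′ m n → + 2 ℤ.* + (exponent i j m + exponent i′ j′ n) ≡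
  + i ℤ.* (m ℤ.* m ℤ.+ m) ℤ.+ + j ℤ.* (m ℤ.* m ℤ.- m) ℤ.+ (+ i′ ℤ.* (n ℤ.* n ℤ.+ n) ℤ.+ + j′ ℤ.* (n ℤ.* n ℤ.- n))
2*sum i j i′ j′ m n = trans (ℤ.*-distribˡ-+ (+ 2) (+ exponent i j m) (+ exponent i′ j′ n))
  (cong₂ ℤ._+_ (2*exponent i j m) (2*exponent i′ j′ n))

-- With m = s + t and n = s - t the cross terms of 3m² and 3n² cancel: 3m² - 2m + 3n² = (6s² - 2s) +
-- (6t² - 2t). The sign (-1)^m splits likewise.
term-even : ∀ {K} s t → term⁻ 1 5 (s ℤ.+ t) ⊛ term⁺ 3 3 (s ℤ.- t) ≈[ K ] term⁻ 4 8 s ⊛ term⁻ 4 8 t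
term-even {K} s t = ≈-trans (mono-*-mono _ _ _ _) (≈-trans (mono-cong signs exponents) (≈-sym (mono-*-mono _ _ _ _)))
  where
  open Mod K
  signs : sgn⁻ (s ℤ.+ t) ℤ.* 1ℤ ℤ.^ ∣ s ℤ.- t ∣ ≡ sgn⁻ s ℤ.* sgn⁻ t
  signs = trans (cong (sgn⁻ (s ℤ.+ t) ℤ.*_) (1^n≡1 ∣ s ℤ.- t ∣)) (trans (ℤ.*-identityʳ _) (Sign.sgn-+ -1ℤ refl s t))
  lemma : ∀ s t → + 1 ℤ.* ((s ℤ.+ t) ℤ.* (s ℤ.+ t) ℤ.+ (s ℤ.+ t)) ℤ.+ + 5 ℤ.* ((s ℤ.+ t) ℤ.* (s ℤ.+ t) ℤ.- (s ℤ.+ t))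
    ℤ.+ (+ 3 ℤ.* ((s ℤ.- t) ℤ.* (s ℤ.- t) ℤ.+ (s ℤ.- t)) ℤ.+ + 3 ℤ.* ((s ℤ.- t) ℤ.* (s ℤ.- t) ℤ.- (s ℤ.- t)))
    ≡ + 4 ℤ.* (s ℤ.* s ℤ.+ s) ℤ.+ + 8 ℤ.* (s ℤ.* s ℤ.- s) ℤ.+ (+ 4 ℤ.* (t ℤ.* t ℤ.+ t) ℤ.+ + 8 ℤ.* (t ℤ.* t ℤ.- t))
  lemma = solve-∀
  exponents : exponent 1 5 (s ℤ.+ t) + exponent 3 3 (s ℤ.- t) ≡ exponent 4 8 s + exponent 4 8 t
  exponents = 2*-injective (trans (2*sum 1 5 3 3 (s ℤ.+ t) (s ℤ.- t)) (trans (lemma s t) (sym (2*sum 4 8 4 8 s t))))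

-- With m = 1 + s + t the exponent becomes 1 + (6s² + 4s) + (6t² + 4t). The extra 1 in the exponent
-- and the extra sign of m form the factor -q.
term-odd : ∀ {K} s t → term⁻ 1 5 (1ℤ
      ℤ.+ (s ℤ.+ t)) ⊛ term⁺ 3 3 (s ℤ.- t) ≈[ K ] mono -1ℤ 1 ⊛ (term⁻ 10 2 s ⊛ term⁻ 10 2 t)
term-odd {K} s t = ≈-trans (mono-*-mono _ _ _ _) (≈-trans (mono-cong signs exponents)
  (≈-sym (≈-trans (*-congˡ (mono-*-mono _ _ _ _)) (mono-*-mono _ _ _ _))))
  where
  open Mod K
  signs : sgn⁻ (1ℤ ℤ.+ (s ℤ.+ t)) ℤ.* 1ℤ ℤ.^ ∣ s ℤ.- t ∣ ≡ -1ℤ ℤ.* (sgn⁻ s ℤ.* sgn⁻ t)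
  signs = trans (cong (sgn⁻ (1ℤ ℤ.+ (s ℤ.+ t)) ℤ.*_) (1^n≡1 ∣ s ℤ.- t ∣)) (trans (ℤ.*-identityʳ _)
    (trans (Sign.sgn-suc -1ℤ refl (s ℤ.+ t)) (cong (-1ℤ ℤ.*_) (Sign.sgn-+ -1ℤ refl s t))))
  lemma : ∀ s t → + 1 ℤ.* ((1ℤ ℤ.+ (s ℤ.+ t)) ℤ.* (1ℤ ℤ.+ (s ℤ.+ t)) ℤ.+ (1ℤ ℤ.+ (s ℤ.+ t))) ℤ.+ + 5 ℤ.* ((1ℤ
        ℤ.+ (s ℤ.+ t)) ℤ.* (1ℤ ℤ.+ (s ℤ.+ t)) ℤ.- (1ℤ ℤ.+ (s ℤ.+ t)))
    ℤ.+ (+ 3 ℤ.* ((s ℤ.- t) ℤ.* (s ℤ.- t) ℤ.+ (s ℤ.- t)) ℤ.+ + 3 ℤ.* ((s ℤ.- t) ℤ.* (s ℤ.- t) ℤ.- (s ℤ.- t)))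
    ≡ + 2 ℤ.* 1ℤ ℤ.+ (+ 10 ℤ.* (s ℤ.* s ℤ.+ s) ℤ.+ + 2 ℤ.* (s ℤ.* s ℤ.- s)
          ℤ.+ (+ 10 ℤ.* (t ℤ.* t ℤ.+ t) ℤ.+ + 2 ℤ.* (t ℤ.* t ℤ.- t)))
  lemma = solve-∀
  exponents : exponent 1 5 (1ℤ ℤ.+ (s ℤ.+ t)) + exponent 3 3 (s ℤ.- t) ≡ 1 + (exponent 10 2 s + exponent 10 2 t)
  exponents = 2*-injective (trans (2*sum 1 5 3 3 (1ℤ ℤ.+ (s ℤ.+ t)) (s ℤ.- t)) (trans (lemma s t)
    (trans (cong (λ x → + 2 ℤ.* 1ℤ ℤ.+ x) (sym (2*sum 10 2 10 2 s t))) (sym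
          (ℤ.*-distribˡ-+ (+ 2) 1ℤ (+ (exponent 10 2 s + exponent 10 2 t)))))))

-- The q-term is added on the left instead of subtracted on the right, because the calculations take
-- place in a semiring.
theta-dissection : ∀ {K} → θ⁻ 1 5 ⊛ θ⁺ 3 3 ⊕ mono 1ℤ 1 ⊛ (θ⁻ 10 2 ⊛ θ⁻ 10 2) ≈[ K ] θ⁻ 4 8 ⊛ θ⁻ 4 8
theta-dissection {K} = begin
  θ⁻ 1 5 ⊛ θ⁺ 3 3 ⊕ q ⊛ θ² ≈⟨ +-congʳ product ⟩
  (θ⁻ 4 8 ⊛ θ⁻ 4 8 ⊕ mono -1ℤ 1 ⊛ θ²) ⊕ q ⊛ θ²
    ≈⟨ solve 4 (λ a x y b → (a :+ x :* b) :+ y :* b := a :+ (x :+ y) :* b)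
          ≈-refl (θ⁻ 4 8 ⊛ θ⁻ 4 8) (mono -1ℤ 1) q θ² ⟩
  θ⁻ 4 8 ⊛ θ⁻ 4 8 ⊕ (mono -1ℤ 1 ⊕ q) ⊛ θ²
    ≈⟨ +-congˡ (≈-trans (*-congʳ (≈-trans (mono-⊕-mono -1ℤ 1ℤ 1) (mono-0 1))) (zeroˡ θ²)) ⟩
  θ⁻ 4 8 ⊛ θ⁻ 4 8 ⊕ 0# ≈⟨ +-identityʳ _ ⟩
  θ⁻ 4 8 ⊛ θ⁻ 4 8 ∎
  where
  open Mod K
  q θ² : Series
  q = mono 1ℤ 1
  θ² = θ⁻ 10 2 ⊛ θ⁻ 10 2
  N : ℕ
  N = parityBox-radius K
  K≤N : K ≤ N
  K≤N = ℕ.≤-trans (ℕ.m≤m+n K _) (ℕ.m≤m+n _ 1)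
  g : ℤ × ℤ → Series
  g (m , n) = term⁻ 1 5 m ⊛ term⁺ 3 3 n
  g≈0 : ∀ m n → K ℕ.< ∣ m ∣ ⊎ K ℕ.< ∣ n ∣ → g (m , n) ≈ 0#
  g≈0 m n (inj₁ K<m) = ≈-trans (*-congʳ (mono-below _ _ (ℕ.<-≤-trans K<m (∣n∣≤exponent 1 5 m)))) (zeroˡ _)
  g≈0 m n (inj₂ K<n) = ≈-trans (*-congˡ (mono-below _ _ (ℕ.<-≤-trans K<n (∣n∣≤exponent 3 3 n)))) (zeroʳ _)
  -- The sum formula for a theta series holds on every window of radius at least K, so the enlarged
  -- box still factors into a square.
  square : ∀ i j .{{_ : NonZero i}} .{{_ : NonZero j}} .{{_ : NonZero (i + j)}} →
    ∑ (box N) (λ (s , t) → term⁻ i j s ⊛ term⁻ i j t) ≈ θ⁻ i j ⊛ θ⁻ i j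
  square i j = ≈-sym (≈-trans (*-cong (theta≈∑ -1ℤ refl i j K≤N) (theta≈∑ -1ℤ refl i j K≤N))
    (∑-⊛-∑ (term⁻ i j) (term⁻ i j) (window N) (window N)))
  product : θ⁻ 1 5 ⊛ θ⁺ 3 3 ≈ θ⁻ 4 8 ⊛ θ⁻ 4 8 ⊕ mono -1ℤ 1 ⊛ θ²
  product = begin
    θ⁻ 1 5 ⊛ θ⁺ 3 3
      ≈⟨ *-cong (theta≈∑ -1ℤ refl 1 5 ℕ.≤-refl) (theta≈∑ 1ℤ refl 3 3 ℕ.≤-refl) ⟩
    ∑ (window K) (term⁻ 1 5) ⊛ ∑ (window K) (term⁺ 3 3)
      ≈⟨ ∑-⊛-∑ (term⁻ 1 5) (term⁺ 3 3) (window K) (window K) ⟩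
    ∑ (box K) g
      ≈⟨ ∑-box≈∑-parityBox g g≈0 ⟩
    ∑ (box N) (g ∘ even) ⊕ ∑ (box N) (g ∘ odd)
      ≈⟨ +-cong (∑-cong (box N) λ (s , t) → term-even s t) (∑-cong (box N) λ (s , t) → term-odd s t) ⟩
    ∑ (box N) (λ (s , t) → term⁻ 4 8 s ⊛ term⁻ 4 8 t) ⊕ ∑ (box N)
          (λ (s , t) → mono -1ℤ 1 ⊛ (term⁻ 10 2 s ⊛ term⁻ 10 2 t))
      ≈⟨ +-cong (square 4 8) (≈-trans (≈-sym (⊛-∑ (mono -1ℤ 1) (box N))) (*-congˡ (square 10 2))) ⟩
    θ⁻ 4 8 ⊛ θ⁻ 4 8 ⊕ mono -1ℤ 1 ⊛ θ² ∎

-- Product formulas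

infixr 8 _↑_

-- A power built on the opaque product; once `_⊛_` is unfolded it agrees by computation with the
-- power in the definition of a(q), as `a⊛D-f` requires.
_↑_ : Series → ℕ → Series
A ↑ zero  = 1#
A ↑ suc n = A ⊛ A ↑ n

↑-cong : ∀ {K A B} n → A ≈[ K ] B → A ↑ n ≈[ K ] B ↑ n
↑-cong {K} zero    A≈B = Mod.≈-refl K
↑-cong     (suc n) A≈B = ⊛-cong A≈B (↑-cong n A≈B)

1↑ : ∀ {K A} n → A ≈[ K ] 1# → A ↑ n ≈[ K ] 1#
1↑ {K} zero    A≈1 = Mod.≈-refl K
1↑ {K} (suc n) A≈1 = Mod.≈-trans K (⊛-cong A≈1 (1↑ n A≈1)) (Mod.*-identityˡ K 1#)

module ProductIdentities (K : ℕ) where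
  open Mod K

  private
    module S = ·-Solver

  pow : ∀ {n} → S.Expr n → ℕ → S.Expr n
  pow x zero    = S.id
  pow x (suc n) = x S.⊕ pow x n

  -- Euler's pentagonal case: the classes 4, 8 and 12 modulo 12 make up all multiples of 4.
  θ⁻-4-8 : θ⁻ 4 8 ≈ euler 4
  θ⁻-4-8 = ≈-sym (binomials-split₃ -1ℤ 4 4)

  -- The classes 1 and 5 modulo 6 are the odd numbers without the odd multiples of 3, giving
  -- (f₁/f₂)(f₆/f₃) times the factor f₆ of the theta product.
  θ⁻-1-5 : θ⁻ 1 5 ⊛ (euler 2 ⊛ euler 3) ≈ euler 1 ⊛ euler 6 ↑ 2
  θ⁻-1-5 = begin
    a ⊛ b ⊛ euler 6 ⊛ (euler 2 ⊛ euler 3) ≈⟨ *-congˡ (*-congˡ (binomials-split₂ -1ℤ 3 3)) ⟩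
    a ⊛ b ⊛ euler 6 ⊛ (euler 2 ⊛ (c ⊛ euler 6))
      ≈⟨ solve 5 (λ a b c x y → a :* b :* y :* (x :* (c :* y)) := a :* c :* b :* x :* (y :* (y :* con 1)))
            ≈-refl a b c (euler 2) (euler 6) ⟩
    a ⊛ c ⊛ b ⊛ euler 2 ⊛ euler 6 ↑ 2 ≈⟨ *-congʳ (*-congʳ (binomials-split₃ -1ℤ 1 2)) ⟨
    binomials -1ℤ 1 2 ⊛ euler 2 ⊛ euler 6 ↑ 2 ≈⟨ *-congʳ (binomials-split₂ -1ℤ 1 1) ⟨
    euler 1 ⊛ euler 6 ↑ 2 ∎
    where
    a b c : Series
    a = binomials -1ℤ 1 6
    b = binomials -1ℤ 5 6
    c = binomials -1ℤ 3 6

  -- The same argument as for `θ⁻-1-5`, with q² in place of q.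
  θ⁻-10-2 : θ⁻ 10 2 ⊛ (euler 4 ⊛ euler 6) ≈ euler 2 ⊛ euler 12 ↑ 2
  θ⁻-10-2 = begin
    b ⊛ a ⊛ euler 12 ⊛ (euler 4 ⊛ euler 6) ≈⟨ *-congˡ (*-congˡ (binomials-split₂ -1ℤ 6 6)) ⟩
    b ⊛ a ⊛ euler 12 ⊛ (euler 4 ⊛ (c ⊛ euler 12))
      ≈⟨ solve 5 (λ a b c x y → b :* a :* y :* (x :* (c :* y)) := a :* c :* b :* x :* (y :* (y :* con 1)))
            ≈-refl a b c (euler 4) (euler 12) ⟩
    a ⊛ c ⊛ b ⊛ euler 4 ⊛ euler 12 ↑ 2 ≈⟨ *-congʳ (*-congʳ (binomials-split₃ -1ℤ 2 4)) ⟨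
    binomials -1ℤ 2 4 ⊛ euler 4 ⊛ euler 12 ↑ 2 ≈⟨ *-congʳ (binomials-split₂ -1ℤ 2 2) ⟨
    euler 2 ⊛ euler 12 ↑ 2 ∎
    where
    a b c : Series
    a = binomials -1ℤ 2 12
    b = binomials -1ℤ 10 12
    c = binomials -1ℤ 6 12

  -- Euler's formula for φ(q³). The product over 1 + q^(3+6k) becomes f₆²/(f₃f₁₂) after
  -- multiplication by the product over 1 - q^(3+6k), which is f₃/f₆.
  θ⁺-3-3 : θ⁺ 3 3 ⊛ (euler 3 ↑ 2 ⊛ euler 12 ↑ 2) ≈ euler 6 ↑ 5
  θ⁺-3-3 = begin
    p ⊛ p ⊛ euler 6 ⊛ (euler 3 ↑ 2 ⊛ euler 12 ↑ 2)
      ≈⟨ *-congˡ (*-congʳ (↑-cong 2 (binomials-split₂ -1ℤ 3 3))) ⟩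
    p ⊛ p ⊛ euler 6 ⊛ ((o ⊛ euler 6) ↑ 2 ⊛ euler 12 ↑ 2)
      ≈⟨ S.solve 4 (λ p o x y → (((p S.⊕ p) S.⊕ x) S.⊕ (pow (o S.⊕ x) 2 S.⊕ pow y 2))
            S.⊜ (pow ((p S.⊕ o) S.⊕ y) 2 S.⊕ pow x 3))
            ≈-refl p o (euler 6) (euler 12) ⟩
    (p ⊛ o ⊛ euler 12) ↑ 2 ⊛ euler 6 ↑ 3
      ≈⟨ *-congʳ (↑-cong 2 (≈-trans (*-congʳ (binomials-± 3 6)) (≈-sym (binomials-split₂ -1ℤ 6 6)))) ⟩
    euler 6 ↑ 2 ⊛ euler 6 ↑ 3
      ≈⟨ S.solve 1 (λ x → (pow x 2 S.⊕ pow x 3) S.⊜ pow x 5) ≈-refl (euler 6) ⟩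
    euler 6 ↑ 5 ∎
    where
    p o : Series
    p = binomials 1ℤ 3 6
    o = binomials -1ℤ 3 6

  -- The exponents of f(q², q⁶) are 4n² - 2n = 2n(2n - 1) with n in ℤ. They run once through m(m +
  -- 1) for m ≥ 0, so the series is ψ(q²).
  θ⁺-2-6 : θ⁺ 2 6 ⊛ euler 2 ≈ euler 4 ↑ 2
  θ⁺-2-6 = begin
    θ⁺ 2 6 ⊛ euler 2
      ≈⟨ *-cong (*-congʳ (binomials-split₂ 1ℤ 2 4)) (≈-sym (binomials-split₂ -1ℤ 2 2)) ⟨
    p ⊛ euler 8 ⊛ (o ⊛ euler 4)
      ≈⟨ S.solve 4 (λ p o x y → ((p S.⊕ x) S.⊕ (o S.⊕ y)) S.⊜ (((p S.⊕ o) S.⊕ x) S.⊕ (y S.⊕ S.id)))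
            ≈-refl p o (euler 8) (euler 4) ⟩
    p ⊛ o ⊛ euler 8 ⊛ euler 4 ↑ 1
      ≈⟨ *-congʳ (≈-trans (*-congʳ (binomials-± 2 4)) (≈-sym (binomials-split₂ -1ℤ 4 4))) ⟩
    euler 4 ↑ 2 ∎
    where
    p o : Series
    p = binomials 1ℤ 2 4
    o = binomials -1ℤ 2 4

  binomials-6-6 : binomials 1ℤ 6 6 ⊛ euler 6 ≈ euler 12
  binomials-6-6 = binomials-± 6 6

-- ψ is the series ψ(q²), and a(q) = evenPart - q oddPart.
ψ f₁₂/f₆ evenPart oddPart : Series
ψ = θ⁺ 2 6
f₁₂/f₆ = binomials 1ℤ 6 6
evenPart = ψ ↑ 2 ⊛ (f₁₂/f₆ ↑ 2 ⊛ partition 6 ↑ 5)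
oddPart = f₁₂/f₆ ↑ 6 ⊛ partition 6 ↑ 3

-- From the theta identity to a(q)

module Dissection (K : ℕ) where
  open Mod K
  open ProductIdentities K
  private
    module S = ·-Solver

  -- The denominator of a(q). Below, e with index j is f_j and i with index j is its inverse.
  D : Series
  D = euler 2 ↑ 3 ⊛ euler 3 ↑ 3

  e₁ e₂ e₃ e₄ e₆ e₁₂ i₂ i₃ i₄ i₆ i₁₂ M : Series
  e₁ = euler 1
  e₂ = euler 2
  e₃ = euler 3
  e₄ = euler 4
  e₆ = euler 6
  e₁₂ = euler 12
  i₂ = partition 2
  i₃ = partition 3
  i₄ = partition 4
  i₆ = partition 6
  i₁₂ = partition 12
  -- This is f₂f₃³f₄²f₁₂²/f₆⁷, chosen so that `M` times f(-q,-q⁵) φ(q³) = f₁f₆⁷/(f₂f₃³f₁₂²) is the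
  -- numerator of a(q).
  M = e₄ ↑ 2 ⊛ (i₂ ↑ 2 ⊛ (e₁₂ ↑ 2 ⊛ (i₆ ↑ 7 ⊛ D)))

  divide : ∀ {A B E I} → A ⊛ E ≈ B → E ⊛ I ≈ 1# → A ≈ B ⊛ I
  divide {A} {B} {E} {I} AE≈B EI≈1 = begin
    A           ≈⟨ *-identityʳ A ⟨
    A ⊛ 1#      ≈⟨ *-congˡ EI≈1 ⟨
    A ⊛ (E ⊛ I) ≈⟨ *-assoc A E I ⟨
    A ⊛ E ⊛ I   ≈⟨ *-congʳ AE≈B ⟩
    B ⊛ I       ∎

  unit₂ : e₂ ⊛ i₂ ≈ 1#
  unit₂ = ≈-trans (*-comm e₂ i₂) (partition-⊛-euler 2)
  unit₃ : e₃ ⊛ i₃ ≈ 1#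
  unit₃ = ≈-trans (*-comm e₃ i₃) (partition-⊛-euler 3)
  unit₄ : e₄ ⊛ i₄ ≈ 1#
  unit₄ = ≈-trans (*-comm e₄ i₄) (partition-⊛-euler 4)
  unit₆ : e₆ ⊛ i₆ ≈ 1#
  unit₆ = ≈-trans (*-comm e₆ i₆) (partition-⊛-euler 6)
  unit₁₂ : e₁₂ ⊛ i₁₂ ≈ 1#
  unit₁₂ = ≈-trans (*-comm e₁₂ i₁₂) (partition-⊛-euler 12)

  _⟨·⟩_ : ∀ {A B} → A ≈ 1# → B ≈ 1# → A ⊛ B ≈ 1#
  A≈1 ⟨·⟩ B≈1 = ≈-trans (*-cong A≈1 B≈1) (*-identityˡ 1#)

  ψ≈ : ψ ≈ e₄ ↑ 2 ⊛ i₂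
  ψ≈ = divide θ⁺-2-6 unit₂

  f₁₂/f₆≈ : f₁₂/f₆ ≈ e₁₂ ⊛ i₆
  f₁₂/f₆≈ = divide binomials-6-6 unit₆

  evenPart⊛D≈ : evenPart ⊛ D ≈ M ⊛ e₄ ↑ 2
  evenPart⊛D≈ = begin
    evenPart ⊛ D ≈⟨ *-congʳ (*-cong (↑-cong 2 ψ≈) (*-congʳ (↑-cong 2 f₁₂/f₆≈))) ⟩
    (e₄ ↑ 2 ⊛ i₂) ↑ 2 ⊛ ((e₁₂ ⊛ i₆) ↑ 2 ⊛ i₆ ↑ 5) ⊛ D
      ≈⟨ S.solve 5 (λ e₄ i₂ e₁₂ i₆ d →
          ((pow (pow e₄ 2 S.⊕ i₂) 2 S.⊕ (pow (e₁₂ S.⊕ i₆) 2 S.⊕ pow i₆ 5)) S.⊕ d)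
          S.⊜ ((pow e₄ 2 S.⊕ (pow i₂ 2 S.⊕ (pow e₁₂ 2 S.⊕ (pow i₆ 7 S.⊕ d)))) S.⊕ pow e₄ 2))
          ≈-refl e₄ i₂ e₁₂ i₆ D ⟩
    M ⊛ e₄ ↑ 2 ∎

  M⊛W₁⊛Φ≈ : M ⊛ (θ⁻ 1 5 ⊛ θ⁺ 3 3) ≈ e₁ ⊛ e₄ ↑ 2
  M⊛W₁⊛Φ≈ = begin
    M ⊛ (θ⁻ 1 5 ⊛ θ⁺ 3 3)
      ≈⟨ *-congˡ (*-cong (divide θ⁻-1-5 unit₂₃) (divide θ⁺-3-3 unit₃₁₂)) ⟩
    M ⊛ (e₁ ⊛ e₆ ↑ 2 ⊛ (i₂ ⊛ i₃) ⊛ (e₆ ↑ 5 ⊛ (i₃ ↑ 2 ⊛ i₁₂ ↑ 2)))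
      -- The solver for commutative monoids knows no inverses: each cancelling factor is first
      -- paired with its inverse, and the pairs are then replaced by 1.
      ≈⟨ S.solve 10 (λ e₁ e₂ i₂ e₃ i₃ e₄ e₆ i₆ e₁₂ i₁₂ →
          ((pow e₄ 2 S.⊕ (pow i₂ 2 S.⊕ (pow e₁₂ 2 S.⊕ (pow i₆ 7 S.⊕ (pow e₂ 3 S.⊕ pow e₃ 3)))))
           S.⊕ (((e₁ S.⊕ pow e₆ 2) S.⊕ (i₂ S.⊕ i₃)) S.⊕ (pow e₆ 5 S.⊕ (pow i₃ 2 S.⊕ pow i₁₂ 2))))
          S.⊜ ((e₁ S.⊕ pow e₄ 2) S.⊕ ((pow (e₂ S.⊕ i₂) 3 S.⊕ pow (e₃ S.⊕ i₃) 3) S.⊕ (pow (e₆ S.⊕ i₆) 7 S.⊕ pow (e₁₂ S.⊕ i₁₂) 2))))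
          ≈-refl e₁ e₂ i₂ e₃ i₃ e₄ e₆ i₆ e₁₂ i₁₂ ⟩
    (e₁ ⊛ e₄ ↑ 2) ⊛ ((e₂ ⊛ i₂) ↑ 3 ⊛ (e₃ ⊛ i₃) ↑ 3 ⊛ ((e₆ ⊛ i₆) ↑ 7 ⊛ (e₁₂ ⊛ i₁₂) ↑ 2))
      ≈⟨ *-congˡ ((1↑ 3 unit₂ ⟨·⟩ 1↑ 3 unit₃) ⟨·⟩ (1↑ 7 unit₆ ⟨·⟩ 1↑ 2 unit₁₂)) ⟩
    e₁ ⊛ e₄ ↑ 2 ⊛ 1# ≈⟨ *-identityʳ _ ⟩
    e₁ ⊛ e₄ ↑ 2 ∎
    where
    unit₂₃ : e₂ ⊛ e₃ ⊛ (i₂ ⊛ i₃) ≈ 1#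
    unit₂₃ = ≈-trans (S.solve 4 (λ a b c d → ((a S.⊕ b) S.⊕ (c S.⊕ d)) S.⊜ ((a S.⊕ c) S.⊕ (b S.⊕ d)))
          ≈-refl e₂ e₃ i₂ i₃) (unit₂ ⟨·⟩ unit₃)
    unit₃₁₂ : e₃ ↑ 2 ⊛ e₁₂ ↑ 2 ⊛ (i₃ ↑ 2 ⊛ i₁₂ ↑ 2) ≈ 1#
    unit₃₁₂ = ≈-trans (S.solve 4 (λ a b c d → ((pow a 2 S.⊕ pow b 2) S.⊕ (pow c 2 S.⊕ pow d 2))
          S.⊜ (pow (a S.⊕ c) 2 S.⊕ pow (b S.⊕ d) 2))
          ≈-refl e₃ e₁₂ i₃ i₁₂) (1↑ 2 unit₃ ⟨·⟩ 1↑ 2 unit₁₂)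

  M⊛W₂²≈ : M ⊛ (θ⁻ 10 2 ⊛ θ⁻ 10 2) ≈ oddPart ⊛ D
  M⊛W₂²≈ = begin
    M ⊛ (θ⁻ 10 2 ⊛ θ⁻ 10 2) ≈⟨ *-congˡ (*-cong W₂≈ W₂≈) ⟩
    M ⊛ ((e₂ ⊛ e₁₂ ↑ 2 ⊛ (i₄ ⊛ i₆)) ⊛ (e₂ ⊛ e₁₂ ↑ 2 ⊛ (i₄ ⊛ i₆)))
      ≈⟨ S.solve 7 (λ e₂ i₂ e₄ i₄ i₆ e₁₂ d →
          ((pow e₄ 2 S.⊕ (pow i₂ 2 S.⊕ (pow e₁₂ 2 S.⊕ (pow i₆ 7 S.⊕ d))))
           S.⊕ (((e₂ S.⊕ pow e₁₂ 2) S.⊕ (i₄ S.⊕ i₆)) S.⊕ ((e₂ S.⊕ pow e₁₂ 2) S.⊕ (i₄ S.⊕ i₆))))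
          S.⊜ (((pow (e₁₂ S.⊕ i₆) 6 S.⊕ pow i₆ 3) S.⊕ d) S.⊕ (pow (e₂ S.⊕ i₂) 2 S.⊕ pow (e₄ S.⊕ i₄) 2)))
          ≈-refl e₂ i₂ e₄ i₄ i₆ e₁₂ D ⟩
    (e₁₂ ⊛ i₆) ↑ 6 ⊛ i₆ ↑ 3 ⊛ D ⊛ ((e₂ ⊛ i₂) ↑ 2 ⊛ (e₄ ⊛ i₄) ↑ 2)
      ≈⟨ *-cong (*-congʳ (*-congʳ (↑-cong 6 (≈-sym f₁₂/f₆≈)))) (1↑ 2 unit₂ ⟨·⟩ 1↑ 2 unit₄) ⟩
    oddPart ⊛ D ⊛ 1# ≈⟨ *-identityʳ _ ⟩
    oddPart ⊛ D ∎
    where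
    unit₄₆ : e₄ ⊛ e₆ ⊛ (i₄ ⊛ i₆) ≈ 1#
    unit₄₆ = ≈-trans (S.solve 4 (λ a b c d → ((a S.⊕ b) S.⊕ (c S.⊕ d)) S.⊜ ((a S.⊕ c) S.⊕ (b S.⊕ d)))
          ≈-refl e₄ e₆ i₄ i₆) (unit₄ ⟨·⟩ unit₆)
    W₂≈ : θ⁻ 10 2 ≈ e₂ ⊛ e₁₂ ↑ 2 ⊛ (i₄ ⊛ i₆)
    W₂≈ = divide θ⁻-10-2 unit₄₆

  q : Series
  q = mono 1ℤ 1

  -- `theta-dissection` multiplied by `M`.
  evenPart⊛D-dissection : evenPart ⊛ D ≈ e₁ ⊛ e₄ ↑ 2 ⊕ q ⊛ (oddPart ⊛ D)
  evenPart⊛D-dissection = begin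
    evenPart ⊛ D ≈⟨ evenPart⊛D≈ ⟩
    M ⊛ e₄ ↑ 2 ≈⟨ *-congˡ (*-congˡ (*-identityʳ e₄)) ⟩
    M ⊛ (e₄ ⊛ e₄) ≈⟨ *-congˡ (≈-trans theta-dissection (*-cong θ⁻-4-8 θ⁻-4-8)) ⟨
    M ⊛ (θ⁻ 1 5 ⊛ θ⁺ 3 3 ⊕ q ⊛ (θ⁻ 10 2 ⊛ θ⁻ 10 2))
      ≈⟨ solve 4 (λ m a q b → m :* (a :+ q :* b) := m :* a :+ q :* (m :* b))
            ≈-refl M (θ⁻ 1 5 ⊛ θ⁺ 3 3) q (θ⁻ 10 2 ⊛ θ⁻ 10 2) ⟩
    M ⊛ (θ⁻ 1 5 ⊛ θ⁺ 3 3) ⊕ q ⊛ (M ⊛ (θ⁻ 10 2 ⊛ θ⁻ 10 2)) ≈⟨ +-cong M⊛W₁⊛Φ≈ (*-congˡ M⊛W₂²≈) ⟩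
    e₁ ⊛ e₄ ↑ 2 ⊕ q ⊛ (oddPart ⊛ D) ∎

  opaque
    unfolding _⊛_
    a⊛D-f : a1¹2⁻³3⁻³4² ⊛ (f 2 ↑ 3 ⊛ f 3 ↑ 3) ≈ f 1 ⊛ f 4 ↑ 2
    a⊛D-f = ≗⇒≈ a-correct

  a⊛D≈ : a1¹2⁻³3⁻³4² ⊛ D ≈ e₁ ⊛ e₄ ↑ 2
  a⊛D≈ = begin
    a1¹2⁻³3⁻³4² ⊛ D ≈⟨ *-congˡ (*-cong (↑-cong 3 (f≈euler 2)) (↑-cong 3 (f≈euler 3))) ⟨
    a1¹2⁻³3⁻³4² ⊛ (f 2 ↑ 3 ⊛ f 3 ↑ 3) ≈⟨ a⊛D-f ⟩
    f 1 ⊛ f 4 ↑ 2 ≈⟨ *-cong (f≈euler 1) (↑-cong 2 (f≈euler 4)) ⟩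
    e₁ ⊛ e₄ ↑ 2 ∎

  a-dissection : evenPart ≈ a1¹2⁻³3⁻³4² ⊕ q ⊛ oddPart
  a-dissection = ≈-trans (divide (begin
    evenPart ⊛ D ≈⟨ evenPart⊛D-dissection ⟩
    e₁ ⊛ e₄ ↑ 2 ⊕ q ⊛ (oddPart ⊛ D) ≈⟨ +-cong (≈-sym a⊛D≈) (≈-sym (*-assoc q oddPart D)) ⟩
    a1¹2⁻³3⁻³4² ⊛ D ⊕ q ⊛ oddPart ⊛ D ≈⟨ distribʳ D a1¹2⁻³3⁻³4² (q ⊛ oddPart) ⟨
    (a1¹2⁻³3⁻³4² ⊕ q ⊛ oddPart) ⊛ D ∎) unitD) (≈-trans (*-assoc _ D D⁻¹) (≈-trans (*-congˡ unitD) (*-identityʳ _)))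
    where
    D⁻¹ : Series
    D⁻¹ = i₂ ↑ 3 ⊛ i₃ ↑ 3
    unitD : D ⊛ D⁻¹ ≈ 1#
    unitD = ≈-trans (S.solve 4 (λ a b c d → ((pow a 3 S.⊕ pow b 3) S.⊕ (pow c 3 S.⊕ pow d 3))
          S.⊜ (pow (a S.⊕ c) 3 S.⊕ pow (b S.⊕ d) 3))
          ≈-refl e₂ e₃ i₂ i₃) (1↑ 3 unit₂ ⟨·⟩ 1↑ 3 unit₃)

-- Signs and supports of coefficients

NonNegative : Series → Set
NonNegative A = ∀ n → A n ℤ.≥ 0ℤ

SupportedOn : ℕ → Series → Set
SupportedOn d A = ∀ n → d ∤ n → A n ≡ 0ℤ

*-nonNeg : ∀ {x y} → x ℤ.≥ 0ℤ → y ℤ.≥ 0ℤ → x ℤ.* y ℤ.≥ 0ℤ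
*-nonNeg {+ m} {+ n} _ _ = subst (ℤ._≥ 0ℤ) (ℤ.pos-* m n) (+≤+ z≤n)

*-pos : ∀ {x y} → x > 0ℤ → y > 0ℤ → x ℤ.* y > 0ℤ
*-pos {+ suc m} {+ suc n} _ _ = +<+ (s≤s z≤n)
*-pos {+ zero} (+<+ ()) _
*-pos {+ suc m} {+ zero} _ (+<+ ())

1#-nonNegative : NonNegative 1#
1#-nonNegative zero    = +≤+ z≤n
1#-nonNegative (suc n) = +≤+ z≤n

q^-nonNegative : ∀ e → NonNegative (q^ e)
q^-nonNegative zero    n       = 1#-nonNegative n
q^-nonNegative (suc e) zero    = +≤+ z≤n
q^-nonNegative (suc e) (suc n) = q^-nonNegative e n

q^-supported : ∀ e n → n ≢ e → (q^ e) n ≡ 0ℤ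
q^-supported zero    zero    n≢e = ⊥-elim (n≢e refl)
q^-supported zero    (suc n) n≢e = refl
q^-supported (suc e) zero    n≢e = refl
q^-supported (suc e) (suc n) n≢e = q^-supported e n (λ n≡e → n≢e (cong suc n≡e))

1#-supported : ∀ d → SupportedOn d 1#
1#-supported d n d∤n = q^-supported 0 n λ { refl → d∤n (d ∣0) }

opaque
  unfolding _⊕_ _⊛_ mono

  ⊕-nonNegative : ∀ {A B} → NonNegative A → NonNegative B → NonNegative (A ⊕ B)
  ⊕-nonNegative A≥0 B≥0 n = ℤ.+-mono-≤ (A≥0 n) (B≥0 n)

  ⊕-supported : ∀ {d A B} → SupportedOn d A → SupportedOn d B → SupportedOn d (A ⊕ B)
  ⊕-supported A-supp B-supp n d∤n = cong₂ ℤ._+_ (A-supp n d∤n) (B-supp n d∤n)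

  mono-nonNegative : ∀ {c} e → c ℤ.≥ 0ℤ → NonNegative (mono c e)
  mono-nonNegative e c≥0 n = *-nonNeg c≥0 (q^-nonNegative e n)

  mono-supported : ∀ {d} c e → d ∣ e → SupportedOn d (mono c e)
  mono-supported c e d∣e n d∤n = trans (cong (c ℤ.*_) (q^-supported e n λ { refl → d∤n d∣e })) (ℤ.*-zeroʳ c)

  ⊛-nonNegative : ∀ {A B} → NonNegative A → NonNegative B → NonNegative (A ⊛ B)
  ⊛-nonNegative A≥0 B≥0 zero    = ℤ.+-mono-≤ (*-nonNeg (A≥0 0) (B≥0 0)) ℤ.≤-refl
  ⊛-nonNegative A≥0 B≥0 (suc n) = ℤ.+-mono-≤ (*-nonNeg (A≥0 0) (B≥0 (suc n))) (⊛-nonNegative (λ i → A≥0 (suc i)) B≥0 n)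

  -- A convolution of nonnegative terms is positive as soon as one of its products is.
  ⊛-positive : ∀ {A B} → NonNegative A → NonNegative B → ∀ i j → A i > 0ℤ → B j > 0ℤ →
    (A ⊛ B) (i + j) > 0ℤ
  ⊛-positive {A} {B} A≥0 B≥0 zero    zero    Ai>0 Bj>0 = subst (_> 0ℤ) (sym
        (ℤ.+-identityʳ (A 0 ℤ.* B 0))) (*-pos Ai>0 Bj>0)
  ⊛-positive {A} {B} A≥0 B≥0 zero    (suc j) Ai>0 Bj>0 = ℤ.+-mono-<-≤ (*-pos Ai>0 Bj>0) (⊛-nonNegative
        (λ i → A≥0 (suc i)) B≥0 j)
  ⊛-positive {A} {B} A≥0 B≥0 (suc i) j       Ai>0 Bj>0 = ℤ.+-mono-≤-< (*-nonNeg (A≥0 0) (B≥0 (suc i + j)))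
        (⊛-positive {tail A} (λ i → A≥0 (suc i)) B≥0 i j Ai>0 Bj>0)

  ⊛-supported : ∀ {d A B} → SupportedOn d A → SupportedOn d B → SupportedOn d (A ⊛ B)
  ⊛-supported {d} {A} {B} A-supp B-supp n d∤n = go 0 A n A-supp d∤n
    where
    vanish : ∀ {x} k n → (d ∤ k → x ≡ 0ℤ) → d ∤ k + n → x ℤ.* B n ≡ 0ℤ
    vanish {x} k n x-supp d∤k+n with d ∣? k
    ... | no  d∤k = trans (cong (ℤ._* B n) (x-supp d∤k)) (ℤ.*-zeroˡ (B n))
    ... | yes d∣k = trans (cong (x ℤ.*_) (B-supp n λ d∣n → d∤k+n (∣m∣n⇒∣m+n d∣k d∣n))) (ℤ.*-zeroʳ x)
    -- Here `A` is the k-fold tail of the original series, so its index i stands for the exponent k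
    -- + i.
    go : ∀ k (A : Series) n → (∀ i → d ∤ k + i → A i ≡ 0ℤ) → d ∤ k + n → (A ⊛ B) n ≡ 0ℤ
    go k A zero    A-supp d∤k+n = cong (ℤ._+ 0ℤ) (vanish k 0 (λ d∤k → A-supp 0 (subst (d ∤_)
          (sym (ℕ.+-identityʳ k)) d∤k)) d∤k+n)
    go k A (suc n) A-supp d∤k+n = cong₂ ℤ._+_
      (vanish k (suc n) (λ d∤k → A-supp 0 (subst (d ∤_) (sym (ℕ.+-identityʳ k)) d∤k)) d∤k+n)
      (go (suc k) (tail A) n (λ i d∤ → A-supp (suc i) (subst (d ∤_) (sym (ℕ.+-suc k i)) d∤))
            (subst (d ∤_) (ℕ.+-suc k n) d∤k+n))

∏-nonNegative : ∀ {u} → (∀ k → NonNegative (u k)) → ∀ n → NonNegative (∏ u n)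
∏-nonNegative u≥0 zero    = 1#-nonNegative
∏-nonNegative u≥0 (suc n) = ⊛-nonNegative (∏-nonNegative u≥0 n) (u≥0 n)

∏-supported : ∀ {d u} → (∀ k → SupportedOn d (u k)) → ∀ n → SupportedOn d (∏ u n)
∏-supported {d} u-supp zero    = 1#-supported d
∏-supported u-supp (suc n) = ⊛-supported (∏-supported u-supp n) (u-supp n)

↑-nonNegative : ∀ {A} n → NonNegative A → NonNegative (A ↑ n)
↑-nonNegative zero    A≥0 = 1#-nonNegative
↑-nonNegative (suc n) A≥0 = ⊛-nonNegative A≥0 (↑-nonNegative n A≥0)

↑-supported : ∀ {d A} n → SupportedOn d A → SupportedOn d (A ↑ n)
↑-supported {d} zero    A-supp = 1#-supported d
↑-supported     (suc n) A-supp = ⊛-supported A-supp (↑-supported n A-supp)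

↑-positive₀ : ∀ {A} n → NonNegative A → A 0 > 0ℤ → (A ↑ n) 0 > 0ℤ
↑-positive₀ zero    A≥0 A₀>0 = +<+ (s≤s z≤n)
↑-positive₀ (suc n) A≥0 A₀>0 = ⊛-positive A≥0 (↑-nonNegative n A≥0) 0 0 A₀>0 (↑-positive₀ n A≥0 A₀>0)

∑-nonNegative : ∀ {X : Set} {g : X → Series} → (∀ x → NonNegative (g x)) → ∀ xs →
  NonNegative (∑ xs g)
∑-nonNegative g≥0 []       n = +≤+ z≤n
∑-nonNegative g≥0 (x ∷ xs) = ⊕-nonNegative (g≥0 x) (∑-nonNegative g≥0 xs)

∑-supported : ∀ {X : Set} {d} {g : X → Series} → (∀ x → SupportedOn d (g x)) → ∀ xs →
  SupportedOn d (∑ xs g)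
∑-supported g-supp []       n d∤n = refl
∑-supported g-supp (x ∷ xs) = ⊕-supported (g-supp x) (∑-supported g-supp xs)

module _ (r : ℕ) .{{_ : NonZero r}} where

  r∣r+r*k : ∀ k → r ∣ r + r * k
  r∣r+r*k k = ∣m∣n⇒∣m+n ∣-refl (m∣m*n k)

  binomials⁺-nonNegative : NonNegative (binomials 1ℤ r r)
  binomials⁺-nonNegative n = ∏-nonNegative (λ k → ⊕-nonNegative 1#-nonNegative
        (mono-nonNegative (r + r * k) (+≤+ z≤n))) n n

  binomials⁺-supported : SupportedOn r (binomials 1ℤ r r)
  binomials⁺-supported n = ∏-supported (λ k → ⊕-supported (1#-supported r)
        (mono-supported 1ℤ (r + r * k) (r∣r+r*k k))) n n

  geometrics : ℕ → Series
  geometrics k = geometric (r + r * k) {{r+r*k≢0 r}}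

  geometrics-nonNegative : ∀ k → NonNegative (geometrics k)
  geometrics-nonNegative k n = 1#-nonNegative (_%_ n (r + r * k) {{r+r*k≢0 r}})

  geometrics-supported : ∀ k → SupportedOn r (geometrics k)
  geometrics-supported k n r∤n = q^-supported 0 (_%_ n (r + r * k) {{r+r*k≢0 r}}) λ n%d≡0 →
    r∤n (∣-trans (r∣r+r*k k) (m%n≡0⇒n∣m n (r + r * k) {{r+r*k≢0 r}} n%d≡0))

  partition-nonNegative : NonNegative (partition r)
  partition-nonNegative n = ∏-nonNegative geometrics-nonNegative n n

  partition-supported : SupportedOn r (partition r)
  partition-supported n = ∏-supported geometrics-supported n n

  -- The factor 1/(1 - q^r) alone has coefficient 1 at every multiple of r, and all other factors
  -- have constant term 1.
  partition-positive : ∀ n → partition r (r * n) > 0ℤ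
  -- The diagonal product is empty for n = 0; taking one more factor ensures that 1/(1 - q^r) is
  -- always present.
  partition-positive n = subst (_> 0ℤ) (sym (coeff (∏∞≈∏ (partition→1 r) (ℕ.n≤1+n (r * n))) ℕ.≤-refl)) (go (r * n))
    where
    first : geometrics 0 (r * n) > 0ℤ
    first = subst (λ m → 1# m > 0ℤ) (sym (n∣m⇒m%n≡0 (r * n) (r + r * 0) {{r+r*k≢0 r}} r+r*0∣r*n)) (+<+ (s≤s z≤n))
      where
      r+r*0∣r*n : r + r * 0 ∣ r * n
      r+r*0∣r*n = subst (_∣ r * n) (sym (trans (cong (λ x → r + x) (ℕ.*-zeroʳ r)) (ℕ.+-identityʳ r))) (m∣m*n n)
    go : ∀ N → ∏ geometrics (suc N) (r * n) > 0ℤ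
    go zero    = ⊛-positive 1#-nonNegative (geometrics-nonNegative 0) 0 (r * n) (+<+ (s≤s z≤n)) first
    go (suc N) = subst (λ m → ∏ geometrics (suc (suc N)) m > 0ℤ) (ℕ.+-identityʳ (r * n))
      (⊛-positive (∏-nonNegative geometrics-nonNegative (suc N)) (geometrics-nonNegative (suc N)) (r * n) 0 (go N)
        (subst (λ m → 1# m > 0ℤ)
              (sym (n∣m⇒m%n≡0 0 (r + r * suc N) {{r+r*k≢0 r}} ((r + r * suc N) ∣0))) (+<+ (s≤s z≤n))))

-- Signs are read from the sum side of the triple product, since the product side contains
-- `euler 8`, which has negative coefficients.
ψ-coeff : ∀ n → ψ n ≡ ∑ (window n) (term⁺ 2 6) n
ψ-coeff n = coeff (theta≈∑ 1ℤ refl 2 6 (ℕ.≤-refl {n})) ℕ.≤-refl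

ψ-nonNegative : NonNegative ψ
ψ-nonNegative n = subst (ℤ._≥ 0ℤ) (sym (ψ-coeff n))
  (∑-nonNegative (λ m → mono-nonNegative (exponent 2 6 m) (subst (ℤ._≥ 0ℤ) (sym (1^n≡1 ∣ m ∣)) (+≤+ z≤n))) (window n) n)

ψ-supported : SupportedOn 2 ψ
ψ-supported n 2∤n = trans (ψ-coeff n)
  (∑-supported (λ m → mono-supported (1ℤ ℤ.^ ∣ m ∣) (exponent 2 6 m) (∣m∣n⇒∣m+n (m∣m*n (T m)) (∣m⇒∣m*n (T
        (ℤ.pred m)) (from-yes (2 ∣? 6))))) (window n) n 2∤n)

opaque
  unfolding _⊕_ mono

  ∑-term-0 : ∑ (window 0) (term⁺ 2 6) 0 > 0ℤ
  ∑-term-0 = +<+ (s≤s z≤n)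

  ∑-term-2 : ∑ (window 2) (term⁺ 2 6) 2 > 0ℤ
  ∑-term-2 = +<+ (s≤s z≤n)

ψ-positive-0 : ψ 0 > 0ℤ
ψ-positive-0 = subst (_> 0ℤ) (sym (ψ-coeff 0)) ∑-term-0

ψ-positive-2 : ψ 2 > 0ℤ
ψ-positive-2 = subst (_> 0ℤ) (sym (ψ-coeff 2)) ∑-term-2

-- From ψ(q²) = 1 + q² + ... the square reaches 0 + 0, 2 + 0 and 2 + 2, one exponent for each even
-- residue modulo 6. Multiples of 6 are then added by the other factors of `evenPart`.
ψ²-positive : ∀ r → r ℕ.< 3 → (ψ ↑ 2) (2 * r) > 0ℤ
ψ²-positive 0 _ = ↑-positive₀ 2 ψ-nonNegative ψ-positive-0
ψ²-positive 1 _ = ⊛-positive ψ-nonNegative (↑-nonNegative 1 ψ-nonNegative) 2 0 ψ-positive-2 (↑-positive₀ 1 ψ-nonNegative ψ-positive-0)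
ψ²-positive 2 _ = ⊛-positive ψ-nonNegative (↑-nonNegative 1 ψ-nonNegative) 2 2 ψ-positive-2
  (⊛-positive ψ-nonNegative 1#-nonNegative 2 0 ψ-positive-2 (+<+ (s≤s z≤n)))
ψ²-positive (suc (suc (suc _))) (s≤s (s≤s (s≤s ())))

f₁₂/f₆↑-nonNegative : ∀ n → NonNegative (f₁₂/f₆ ↑ n)
f₁₂/f₆↑-nonNegative n = ↑-nonNegative n (binomials⁺-nonNegative 6)

partition↑-nonNegative : ∀ n → NonNegative (partition 6 ↑ n)
partition↑-nonNegative n = ↑-nonNegative n (partition-nonNegative 6)

f₁₂/f₆↑⊛partition↑-positive : ∀ k l n → (f₁₂/f₆ ↑ k ⊛ partition 6 ↑ suc l) (6 * n) > 0ℤ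
f₁₂/f₆↑⊛partition↑-positive k l n = ⊛-positive (f₁₂/f₆↑-nonNegative k) (partition↑-nonNegative (suc l)) 0 (6 * n)
  (↑-positive₀ k (binomials⁺-nonNegative 6) (+<+ (s≤s z≤n)))
  (subst (λ m → (partition 6 ↑ suc l) m > 0ℤ) (ℕ.+-identityʳ (6 * n))
    (⊛-positive (partition-nonNegative 6) (partition↑-nonNegative l) (6 * n) 0 (partition-positive 6 n)
      (↑-positive₀ l (partition-nonNegative 6) (+<+ (s≤s z≤n)))))

evenPart-positive : ∀ n → evenPart (2 * n) > 0ℤ
evenPart-positive n = subst (λ m → evenPart m > 0ℤ) (sym index) (⊛-positive (↑-nonNegative 2 ψ-nonNegative)
  (⊛-nonNegative (f₁₂/f₆↑-nonNegative 2) (partition↑-nonNegative 5)) (2 * (n % 3)) (6 * (n / 3))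
  (ψ²-positive (n % 3) (m%n<n n 3)) (f₁₂/f₆↑⊛partition↑-positive 2 4 (n / 3)))
  where
  index : 2 * n ≡ 2 * (n % 3) + 6 * (n / 3)
  index = trans (cong (2 *_) (m≡m%n+[m/n]*n n 3)) (trans (ℕ.*-distribˡ-+ 2 (n % 3) (n / 3 * 3))
    (cong (λ x → 2 * (n % 3) + x) (trans (cong (2 *_) (ℕ.*-comm (n / 3) 3)) (sym (ℕ.*-assoc 2 3 (n / 3))))))

supported-coarsen : ∀ {d d′ A} → d′ ∣ d → SupportedOn d A → SupportedOn d′ A
supported-coarsen d′∣d A-supp n d′∤n = A-supp n (λ d∣n → d′∤n (∣-trans d′∣d d∣n))

2∣6 : 2 ∣ 6
2∣6 = from-yes (2 ∣? 6)

evenPart-supported : SupportedOn 2 evenPart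
evenPart-supported = ⊛-supported (↑-supported 2 ψ-supported) (⊛-supported
  (↑-supported 2 (supported-coarsen 2∣6 (binomials⁺-supported 6)))
  (↑-supported 5 (supported-coarsen 2∣6 (partition-supported 6))))

oddPart-supported : SupportedOn 6 oddPart
oddPart-supported = ⊛-supported (↑-supported 6 (binomials⁺-supported 6)) (↑-supported 3 (partition-supported 6))

-- Coefficients of a(q)

evenPart-coeff-suc : ∀ n → evenPart (suc n) ≡ a1¹2⁻³3⁻³4² (suc n) ℤ.+ oddPart n
evenPart-coeff-suc n = trans (coeff (Dissection.a-dissection (suc n)) ℕ.≤-refl) (trans (⊕-coeff a1¹2⁻³3⁻³4² _ (suc n))
  (cong (λ x → a1¹2⁻³3⁻³4² (suc n) ℤ.+ x) (trans (mono-⊛ 1ℤ 1 oddPart (suc n)) (ℤ.*-identityˡ (oddPart n)))))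

evenPart-coeff-0 : evenPart 0 ≡ a1¹2⁻³3⁻³4² 0
evenPart-coeff-0 = trans (coeff (Dissection.a-dissection 0) ℕ.≤-refl) (trans (⊕-coeff a1¹2⁻³3⁻³4² _ 0)
  (trans (cong (λ x → a1¹2⁻³3⁻³4² 0 ℤ.+ x) (mono-⊛ 1ℤ 1 oddPart 0)) (ℤ.+-identityʳ _)))

a-suc : ∀ n → a1¹2⁻³3⁻³4² (suc n) ≡ evenPart (suc n) ℤ.- oddPart n
a-suc n = trans (lemma (a1¹2⁻³3⁻³4² (suc n)) (oddPart n)) (cong (ℤ._- oddPart n) (sym (evenPart-coeff-suc n)))
  where
  lemma : ∀ x y → x ≡ (x ℤ.+ y) ℤ.- y
  lemma = solve-∀

∤-+ : ∀ {d m} n → d ∣ m → d ∤ n → d ∤ m + n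
∤-+ n d∣m d∤n d∣m+n = d∤n (∣m+n∣m⇒∣n d∣m+n d∣m)

-- The exponent is odd, hence outside the support of `evenPart`.
a-6n+suc : ∀ n r → 2 ∤ suc r → a1¹2⁻³3⁻³4² (6 * n + suc r) ≡ ℤ.- oddPart (6 * n + r)
a-6n+suc n r 2∤1+r = begin
  a1¹2⁻³3⁻³4² (6 * n + suc r)          ≡⟨ cong a1¹2⁻³3⁻³4² (ℕ.+-suc (6 * n) r) ⟩
  a1¹2⁻³3⁻³4² (suc (6 * n + r))        ≡⟨ a-suc (6 * n + r) ⟩
  evenPart (suc (6 * n + r)) ℤ.- oddPart (6 * n + r)
    ≡⟨ cong (ℤ._- oddPart (6 * n + r)) (evenPart-supported _ 2∤) ⟩
  0ℤ ℤ.- oddPart (6 * n + r)                ≡⟨ ℤ.+-identityˡ _ ⟩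
  ℤ.- oddPart (6 * n + r)                   ∎
  where
  open ≡-Reasoning
  2∤ : 2 ∤ suc (6 * n + r)
  2∤ = subst (2 ∤_) (ℕ.+-suc (6 * n) r) (∤-+ (suc r) (∣m⇒∣m*n n 2∣6) 2∤1+r)

a-2n-positive : ∀ n → a1¹2⁻³3⁻³4² (2 * n) > 0ℤ
a-2n-positive zero    = subst (_> 0ℤ) evenPart-coeff-0 (evenPart-positive 0)
a-2n-positive (suc n) = subst (_> 0ℤ) (trans (sym (ℤ.+-identityʳ _)) (trans (cong
      (λ y → evenPart (2 * suc n) ℤ.- y) (sym (oddPart-supported _ 6∤)))
      (sym (a-suc (n + suc (n + 0)))))) (evenPart-positive (suc n))
  where
  -- `2 * suc n` computes to the successor of `n + suc (n + 0)`, which is thus the index into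
  -- `oddPart`. If 6 divided it, both it and its successor would be even, and so would 1.
  6∤ : 6 ∤ n + suc (n + 0)
  6∤ 6∣ = from-no (2 ∣? 1) (∣m+n∣m⇒∣n (subst (2 ∣_) (ℕ.+-comm 1 (n + suc (n + 0))) (m∣m*n (suc n))) (∣-trans 2∣6 6∣))

a-6n+suc-zero : ∀ n r → 2 ∤ suc r → 6 ∤ r → a1¹2⁻³3⁻³4² (6 * n + suc r) ≡ 0ℤ
a-6n+suc-zero n r 2∤1+r 6∤r = trans (a-6n+suc n r 2∤1+r) (cong ℤ.-_ (oddPart-supported _ (∤-+ r (m∣m*n n) 6∤r)))

theorem6p2 : (n : ℕ) → (a1¹2⁻³3⁻³4² (2 * n) > 0ℤ) × (a1¹2⁻³3⁻³4² (6 * n + 1) < 0ℤ) × (a1¹2⁻³3⁻³4² (6 * n + 3) ≡ 0ℤ) × (a1¹2⁻³3⁻³4² (6 * n + 5) ≡ 0ℤ)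
theorem6p2 n = a-2n-positive n
  , subst (_< 0ℤ) (sym (a-6n+suc n 0 (from-no (2 ∣? 1)))) (ℤ.neg-mono-< (subst (λ m → oddPart m > 0ℤ)
        (sym (ℕ.+-identityʳ (6 * n))) (f₁₂/f₆↑⊛partition↑-positive 6 2 n)))
  , a-6n+suc-zero n 2 (from-no (2 ∣? 3)) (from-no (6 ∣? 2))
  , a-6n+suc-zero n 4 (from-no (2 ∣? 5)) (from-no (6 ∣? 4))
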